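{- For integers $k\geq 1$ and $0\leq s\leq k$, $$GR_k(s\cdot K_4+e, (k-s)\cdot K_3) =\begin{cases} 17^{s/2}\cdot5^{(k-s)/2}+1, & \text{if $s$ is even and $k-s$ is even,} \\ 2\cdot17^{s/2}\cdot5^{(k-s-1)/2}+1, & \text{if $s$ is even and $k-s$ is odd,} \\ 8\cdot17^{(s-1)/2}\cdot5^{(k-s-1)/2}+1, & \text{if $s$ is odd and $k-s$ is odd,} \\ 4\cdot 17^{(s-1)/2}\cdot5^{(k-s)/2}+1, & \text{if $s$ is odd and $k-s$ is even.}\end{cases}$$
   Context: $K_4+e$ denotes the graph on five vertices consisting of a $K_4$ together with a pendant edge. A Gallai-$k$-coloring is an edge-coloring of a complete graph with colors from $[k]$ containing no rainbow triangle (triangle with three distinct colors). For graphs $H_1,\dots,H_k$, $GR(H_1,\dots,H_k)$ is the minimum integer $N$ such that every Gallai-$k$-coloring of $K_N$ contains, for some $i\in[k]$, a copy of $H_i$ all of whose edges have color $i$. $GR_k(s\cdot K_4+e, (k-s)\cdot K_3)$ denotes $GR(H_1,\dots,H_k)$ with $H_1=\dots=H_s=K_4+e$ and $H_{s+1}=\dots=H_k=K_3$. -}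

module Defs where

open import Data.Nat using (ℕ; zero; suc; _+_; _*_; _∸_; _^_; _<_; _/_; _%_; _<?_)
open import Data.Fin using (Fin; toℕ)
open import Data.Fin.Patterns
open import Data.Product using (Σ; ∃; _×_; _,_)
open import Data.Empty using (⊥)
open import Relation.Nullary using (¬_; yes; no)
open import Relation.Binary.PropositionalEquality using (_≡_; _≢_)
open import Function.Definitions using (Injective)

-- An edge-colouring of the complete graph K_N with colours Fin k:
-- a colour for every ordered pair, symmetric on distinct vertices
-- (values on the diagonal are irrelevant).
record Colouring (N k : ℕ) : Set where
  field
    col : Fin N → Fin N → Fin k
    sym : ∀ x y → x ≢ y → col x y ≡ col y x
open Colouring public

Rainbow : ∀ {N k} → Colouring N k → Fin N → Fin N → Fin N → Set
Rainbow c x y z =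
  (x ≢ y) × (y ≢ z) × (x ≢ z) ×
  (col c x y ≢ col c y z) × (col c y z ≢ col c x z) × (col c x y ≢ col c x z)

Gallai : ∀ {N k} → Colouring N k → Set
Gallai c = ∀ x y z → ¬ Rainbow c x y z

record Graph : Set₁ where
  field
    nV  : ℕ
    Adj : Fin nV → Fin nV → Set
open Graph public

K3 : Graph
K3 = record { nV = 3 ; Adj = λ x y → x ≢ y }

data K4eAdj : Fin 5 → Fin 5 → Set where
  inK4   : ∀ (x y : Fin 5) → toℕ x < 4 → toℕ y < 4 → x ≢ y → K4eAdj x y
  pend   : K4eAdj 3F 4F
  pend'  : K4eAdj 4F 3F

K4e : Graph
K4e = record { nV = 5 ; Adj = K4eAdj }

MonoCopy : ∀ {N k} → Colouring N k → Graph → Fin k → Set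
MonoCopy {N} c H a =
  Σ (Fin (nV H) → Fin N) λ f →
    Injective _≡_ _≡_ f × (∀ u w → Adj H u w → col c (f u) (f w) ≡ a)

Hfam : (k s : ℕ) → Fin k → Graph
Hfam k s i with toℕ i <? s
... | yes _ = K4e
... | no  _ = K3

Arrows : (N k s : ℕ) → Set
Arrows N k s = (c : Colouring N k) → Gallai c →
  ∃ λ (i : Fin k) → MonoCopy c (Hfam k s i) i

IsGR : (k s N : ℕ) → Set
IsGR k s N = Arrows N k s × (∀ M → M < N → ¬ Arrows M k s)

grValue : (k s : ℕ) → ℕ
grValue k s = go (s % 2) ((k ∸ s) % 2)
  where
  t = k ∸ s
  go : ℕ → ℕ → ℕ
  go 0 0 = 17 ^ (s / 2) * 5 ^ (t / 2) + 1
  go 0 _ = 2 * 17 ^ (s / 2) * 5 ^ ((t ∸ 1) / 2) + 1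
  go _ 0 = 4 * 17 ^ ((s ∸ 1) / 2) * 5 ^ (t / 2) + 1
  go _ _ = 8 * 17 ^ ((s ∸ 1) / 2) * 5 ^ ((t ∸ 1) / 2) + 1

{-# OPTIONS --safe #-}

-- Put F s t = g s * h t, where g (2 + s) = 17 g s and h (2 + t) = 5 h t.
--
-- Upper bound, by strong induction on the vertex set S.  A Gallai colouring has a cut
-- of S using at most two colours r, b; refining it as far as possible yields parts any two of
-- which are joined in a single colour, r or b.  If S has a cut in a single colour, then that
-- colour is weakened on both sides.  Otherwise every part has an r-neighbour and a
-- b-neighbour, which excludes a K₄ in r or b (a K₄ without pendant edge would be a union of
-- parts and hence one side of a b- or r-cut).  If no part contains an edge in r or b,
-- then the number of parts is at most 5, 8 or 17 by R(3,3), R(3,4), R(4,4), according to the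
-- graphs forbidden in r and b.  If a part P has, say, an r-edge, then S is split into P, its r-neighbours and its
-- b-neighbours; each lives on fewer or weaker colours, and the three bounds sum to at most F.
--
-- Lower bound: starting from one vertex (s even) or a monochromatic K₄ (s odd), substitute
-- into the Paley colouring of K₁₇ for every further pair of K₄+e colours, then into an edge
-- (t odd), and into the pentagon colouring of K₅ for every pair of K₃ colours.

module Submission where

open import Defs
open import Data.Nat using (ℕ; zero; suc; _+_; _*_; _∸_; _^_; _/_; _%_; _≤_; _<_; z≤n; s≤s; s≤s⁻¹; _≤?_; _<?_; ∣_-_∣)
open import Data.Nat.Properties hiding (_≟_)
open import Data.Nat.DivMod using (m*n%n≡0; m*n/n≡m; [m+kn]%n≡m%n)
open import Data.Bool using (Bool; true; false) renaming (_≟_ to _≟ᵇ_)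
open import Data.Fin using (Fin; toℕ; fromℕ<; punchIn; punchOut; splitAt; _↑ˡ_; _↑ʳ_; remQuot; combine; inject≤)
import Data.Fin as Fin
open import Data.Fin.Patterns
open import Data.Fin.Properties using (_≟_; any?; all?; toℕ<n; toℕ-fromℕ<; toℕ-↑ˡ; toℕ-↑ʳ; splitAt⁻¹-↑ˡ; splitAt⁻¹-↑ʳ; combine-remQuot; inject≤-injective; injective⇒≤)
open import Data.Vec.Functional using (Vector; removeAt) renaming (_∷_ to _∷ᵛ_)
open import Data.Vec.Functional.Properties using (removeAt-punchOut)
open import Data.Vec using (Vec; []; _∷_; lookup)
open import Data.Vec.Relation.Unary.All using ([]; _∷_)
open import Data.Vec.Relation.Unary.AllPairs using ([]; _∷_)
import Data.Vec.Relation.Unary.Unique.Propositional as VecUnique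
open import Data.Vec.Relation.Unary.Unique.Propositional.Properties using (lookup-injective)
open import Data.List using (List; []; _∷_; _++_; length; filter; map; allFin)
open import Data.Nat.ListAction using (sum)
open import Data.List.Properties using (filter-notAll; length-tabulate)
open import Data.List.Membership.Propositional using (_∈_; _∉_; lose; find)
open import Data.List.Membership.Propositional.Properties
  using (∈-filter⁺; ∈-filter⁻; ∈-++⁻)
open import Data.List.Relation.Binary.Subset.Propositional using (_⊆_)
open import Data.List.Relation.Unary.All as All using (All; []; _∷_)
import Data.List.Relation.Unary.All.Properties as All
open import Data.List.Relation.Unary.Any as Any using (Any; here; there)
open import Data.List.Relation.Unary.AllPairs as AllPairs using (AllPairs; []; _∷_)
import Data.List.Relation.Unary.AllPairs.Properties as AllPairs
import Data.List.Relation.Unary.Any.Properties as Any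
open import Data.List.Relation.Unary.Unique.Propositional using (Unique)
open import Data.List.Relation.Unary.Unique.Propositional.Properties using (allFin⁺) renaming (filter⁺ to Unique-filter⁺)
open import Data.Product using (∃; ∃₂; _×_; _,_; proj₁; proj₂)
open import Data.Sum using (_⊎_; inj₁; inj₂; [_,_]′) renaming (swap to ⊎-swap; map to ⊎-map)
open import Data.Sum.Properties using (inj₁-injective; inj₂-injective)
open import Data.Empty using (⊥; ⊥-elim)
open import Function using (_∘_; _$_; id; case_of_)
open import Function.Definitions using (Injective)
open import Relation.Nullary using (¬_; Dec; yes; no; contradiction; Stable; ¬?; _×-dec_; _⊎-dec_; _→-dec_)
open import Relation.Nullary.Decidable using (from-yes; True; toWitness; decidable-stable; ¬¬-excluded-middle)
open import Relation.Unary using (Decidable)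
open import Relation.Binary.PropositionalEquality
  using (_≡_; _≢_; refl; ≢-sym; trans; cong; cong₂; subst; subst₂; module ≡-Reasoning) renaming (sym to ≡-sym)
open import Data.Nat.Tactic.RingSolver using (solve-∀)

-- The extremal function and its numerical inequalities

g h : ℕ → ℕ
g 0 = 1
g 1 = 4
g (suc (suc s)) = 17 * g s
h 0 = 1
h 1 = 2
h (suc (suc t)) = 5 * h t

F : ℕ → ℕ → ℕ
F s t = g s * h t

g-pos : ∀ s → 1 ≤ g s
g-pos 0 = s≤s z≤n
g-pos 1 = s≤s z≤n
g-pos (suc (suc s)) = ≤-trans (g-pos s) (m≤n*m (g s) 17)

h-pos : ∀ t → 1 ≤ h t
h-pos 0 = s≤s z≤n
h-pos 1 = s≤s z≤n
h-pos (suc (suc t)) = ≤-trans (h-pos t) (m≤n*m (h t) 5)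

swap-factors : ∀ a b c → a * (b * c) ≡ b * (a * c)
swap-factors = solve-∀

x∙yz≈y∙xz : ∀ a b c → a + (b + c) ≡ b + (a + c)
x∙yz≈y∙xz = solve-∀

-- The ratio g (suc s) / g s alternates between 4 and 17/4, and h (suc t) / h t between 2 and 5/2.
4g≤g : ∀ s → 4 * g s ≤ g (suc s)
4g≤g 0 = ≤-refl
4g≤g 1 = m≤m+n 16 1
4g≤g (suc (suc s)) = ≤-trans (≤-reflexive (swap-factors 4 17 (g s))) (*-monoʳ-≤ 17 (4g≤g s))

4g≤17g : ∀ s → 4 * g (suc s) ≤ 17 * g s
4g≤17g 0 = m≤m+n 16 1
4g≤17g 1 = ≤-refl
4g≤17g (suc (suc s)) = ≤-trans (≤-reflexive (swap-factors 4 17 (g (suc s)))) (*-monoʳ-≤ 17 (4g≤17g s))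

2h≤h : ∀ t → 2 * h t ≤ h (suc t)
2h≤h 0 = ≤-refl
2h≤h 1 = m≤m+n 4 1
2h≤h (suc (suc t)) = ≤-trans (≤-reflexive (swap-factors 2 5 (h t))) (*-monoʳ-≤ 5 (2h≤h t))

2h≤5h : ∀ t → 2 * h (suc t) ≤ 5 * h t
2h≤5h 0 = m≤m+n 4 1
2h≤5h 1 = ≤-refl
2h≤5h (suc (suc t)) = ≤-trans (≤-reflexive (swap-factors 2 5 (h (suc t)))) (*-monoʳ-≤ 5 (2h≤5h t))

F-pos : ∀ s t → 1 ≤ F s t
F-pos s t = *-mono-≤ (g-pos s) (h-pos t)

4≤F : ∀ s t → 4 ≤ F (suc s) t
4≤F s t = *-mono-≤ (≤-trans (*-monoʳ-≤ 4 (g-pos s)) (4g≤g s)) (h-pos t)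

2F≤5F : ∀ s t → 2 * F s (suc t) ≤ 5 * F s t
2F≤5F s t = ≤-trans (≤-reflexive (swap-factors 2 (g s) (h (suc t))))
  (≤-trans (*-monoʳ-≤ (g s) (2h≤5h t)) (≤-reflexive (swap-factors (g s) 5 (h t))))

4F≤F : ∀ s t → 4 * F s t ≤ F (suc s) t
4F≤F s t = ≤-trans (≤-reflexive (≡-sym (*-assoc 4 (g s) (h t)))) (*-monoˡ-≤ (h t) (4g≤g s))

4F≤17F : ∀ s t → 4 * F (suc s) t ≤ 17 * F s t
4F≤17F s t = ≤-trans (≤-reflexive (≡-sym (*-assoc 4 (g (suc s)) (h t))))
  (≤-trans (*-monoˡ-≤ (h t) (4g≤17g s)) (≤-reflexive (*-assoc 17 (g s) (h t))))

2F≤F : ∀ s t → 2 * F s t ≤ F s (suc t)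
2F≤F s t = ≤-trans (≤-reflexive (swap-factors 2 (g s) (h t))) (*-monoʳ-≤ (g s) (2h≤h t))

-- For a cut in a `K3` colour: both sides lose that colour.
split₂ : ∀ s t → F s t + F s t ≤ F s (suc t)
split₂ s t = ≤-trans (≤-reflexive (cong (F s t +_) (≡-sym (+-identityʳ (F s t))))) (2F≤F s t)

5F≡F : ∀ s t → 5 * F s t ≡ F s (suc (suc t))
5F≡F s t = swap-factors 5 (g s) (h t)

17F≡F : ∀ s t → 17 * F s t ≡ F (suc (suc s)) t
17F≡F s t = ≡-sym (*-assoc 17 (g s) (h t))

-- For a cut in a `K4e` colour: one side loses it, the other keeps it as a `K3` colour. In units of
-- `F s t` the left side is at most 1 + 5/2 and the right side at least 4.
split₃ : ∀ s t → F s t + F s (suc t) ≤ F (suc s) t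
split₃ s t = ≤-trans (*-cancelˡ-≤ 2 bound) (4F≤F s t)
  where
  lem : ∀ u v → 2 * (u + v) ≡ 2 * u + 2 * v
  lem = solve-∀
  lem′ : ∀ u → 2 * u + 5 * u ≤ 2 * (4 * u)
  lem′ u = subst₂ _≤_ (*-distribʳ-+ u 2 5) (*-assoc 2 4 u) (*-monoˡ-≤ u (n≤1+n 7))
  bound : 2 * (F s t + F s (suc t)) ≤ 2 * (4 * F s t)
  bound = ≤-trans (≤-reflexive (lem (F s t) (F s (suc t))))
    (≤-trans (+-monoʳ-≤ (2 * F s t) (2F≤5F s t)) (lem′ (F s t)))

8F≤F : ∀ s t → 8 * F s t ≤ F (suc s) (suc t)
8F≤F s t = ≤-trans (≤-reflexive (*-assoc 4 2 (F s t)))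
  (≤-trans (*-monoʳ-≤ 4 (2F≤F s t)) (4F≤F s (suc t)))

-- Relative to the right side, the three terms are at most 1/4, 1/4 and 1/2.
case₃₂-sum : ∀ s t → F s (suc t) + (F s (suc t) + F (suc s) t) ≤ F (suc s) (suc t)
case₃₂-sum s t = *-cancelˡ-≤ 4 (≤-trans (≤-reflexive (lem (F s (suc t)) (F (suc s) t)))
  (≤-trans (+-mono-≤ (*-monoʳ-≤ 2 (4F≤F s (suc t))) (*-monoʳ-≤ 2 (2F≤F (suc s) t)))
    (≤-reflexive (lem′ (F (suc s) (suc t))))))
  where
  lem : ∀ u v → 4 * (u + (u + v)) ≡ 2 * (4 * u) + 2 * (2 * v)
  lem = solve-∀
  lem′ : ∀ u → 2 * u + 2 * u ≡ 4 * u
  lem′ = solve-∀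

-- In units of `F s t`: at most 5 + 2 (1 + 5/2) = 12 on the left, 17 on the right.
case₃₃-sum₁ : ∀ s t → F s (suc (suc t)) + ((F s t + F s (suc t)) + (F s t + F s (suc t))) ≤ F (suc (suc s)) t
case₃₃-sum₁ s t = begin
  F s (suc (suc t)) + ((F s t + F s (suc t)) + (F s t + F s (suc t)))
    ≡⟨ cong₂ _+_ (≡-sym (5F≡F s t)) (lem (F s t) (F s (suc t))) ⟩
  5 * F s t + (2 * F s t + 2 * F s (suc t))
    ≤⟨ +-monoʳ-≤ (5 * F s t) (+-monoʳ-≤ (2 * F s t) (2F≤5F s t)) ⟩
  5 * F s t + (2 * F s t + 5 * F s t)
    ≡⟨ lem′ (F s t) ⟩
  12 * F s t
    ≤⟨ *-monoˡ-≤ (F s t) (m≤m+n 12 5) ⟩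
  17 * F s t
    ≡⟨ 17F≡F s t ⟩
  F (suc (suc s)) t ∎
  where
  open ≤-Reasoning
  lem : ∀ u v → (u + v) + (u + v) ≡ 2 * u + 2 * v
  lem = solve-∀
  lem′ : ∀ u → 5 * u + (2 * u + 5 * u) ≡ 12 * u
  lem′ = solve-∀

-- In units of `F s t` the left side is at most 5/2 + 7/2 + 85/8 = 133/8, just below 17; multiplying
-- by 8 clears the denominators.
case₃₃-sum₂ : ∀ s t → F s (suc t) + ((F s t + F s (suc t)) + F (suc s) (suc t)) ≤ F (suc (suc s)) t
case₃₃-sum₂ s t = *-cancelˡ-≤ 8 $ begin
  8 * (F s (suc t) + ((F s t + F s (suc t)) + F (suc s) (suc t)))
    ≡⟨ lem (F s t) (F s (suc t)) (F (suc s) (suc t)) ⟩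
  8 * (2 * F s (suc t)) + (8 * F s t + 2 * (4 * F (suc s) (suc t)))
    ≤⟨ +-mono-≤ (*-monoʳ-≤ 8 (2F≤5F s t)) (+-monoʳ-≤ (8 * F s t) (*-monoʳ-≤ 2 (4F≤17F s (suc t)))) ⟩
  8 * (5 * F s t) + (8 * F s t + 2 * (17 * F s (suc t)))
    ≡⟨ lem₂ (F s t) (F s (suc t)) ⟩
  48 * F s t + 17 * (2 * F s (suc t))
    ≤⟨ +-monoʳ-≤ (48 * F s t) (*-monoʳ-≤ 17 (2F≤5F s t)) ⟩
  48 * F s t + 17 * (5 * F s t)
    ≡⟨ lem₃ (F s t) ⟩
  133 * F s t
    ≤⟨ *-monoˡ-≤ (F s t) (m≤m+n 133 3) ⟩
  136 * F s t
    ≡⟨ trans (*-assoc 8 17 (F s t)) (cong (8 *_) (17F≡F s t)) ⟩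
  8 * F (suc (suc s)) t ∎
  where
  open ≤-Reasoning
  lem : ∀ u v w → 8 * (v + ((u + v) + w)) ≡ 8 * (2 * v) + (8 * u + 2 * (4 * w))
  lem = solve-∀
  lem₂ : ∀ u v → 8 * (5 * u) + (8 * u + 2 * (17 * v)) ≡ 48 * u + 17 * (2 * v)
  lem₂ = solve-∀
  lem₃ : ∀ u → 48 * u + 17 * (5 * u) ≡ 133 * u
  lem₃ = solve-∀

-- Counting with duplicate-free lists

length-split : ∀ {A : Set} {P : A → Set} (P? : Decidable P) (xs : List A) →
               length xs ≡ length (filter P? xs) + length (filter (¬? ∘ P?) xs)
length-split P? [] = refl
length-split P? (x ∷ xs) with P? x
... | yes _ = cong suc (length-split P? xs)
... | no  _ = trans (cong suc (length-split P? xs)) (≡-sym (+-suc _ _))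

stable-≤ : ∀ {m n} → Stable (m ≤ n)
stable-≤ {m} {n} = decidable-stable (m ≤? n)

-- An inequality between numbers is stable under double negation, so its proof may distinguish cases
-- on a proposition that is not known to be decidable.
by-cases : ∀ (P : Set) {m n} → (P → m ≤ n) → (¬ P → m ≤ n) → m ≤ n
by-cases P f f′ = stable-≤ λ k → ¬¬-excluded-middle {A = P} λ
  { (yes p) → k (f p)
  ; (no ¬p) → k (f′ ¬p) }

module Bounds {V : Set} (_≟ⱽ_ : (x y : V) → Dec (x ≡ y)) where

  infix 4 _∈?_
  _∈?_ : (x : V) (xs : List V) → Dec (x ∈ xs)
  x ∈? xs = Any.any? (x ≟ⱽ_) xs

  -- Sets are arbitrary predicates; their size is measured by the duplicate-free lists inside them.
  Bound : (V → Set) → ℕ → Set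
  Bound X n = ∀ T → Unique T → (∀ {x} → x ∈ T → X x) → length T ≤ n

  bound-⊆ : ∀ {X Y m n} → (∀ {x} → X x → Y x) → m ≤ n → Bound Y m → Bound X n
  bound-⊆ X⊆Y m≤n b T uniq T⊆X = ≤-trans (b T uniq (X⊆Y ∘ T⊆X)) m≤n

  bound-∪ : ∀ {A X Y Z : V → Set} {m n} → Decidable A →
            (∀ {x} → X x → A x → Y x) → (∀ {x} → X x → ¬ A x → Z x) →
            Bound Y m → Bound Z n → Bound X (m + n)
  bound-∪ A? toY toZ bY bZ T uniq T⊆X = ≤-trans (≤-reflexive (length-split A? T))
    (+-mono-≤
      (bY (filter A? T) (Unique-filter⁺ A? uniq)
        λ x∈ → let x∈T , Ax = ∈-filter⁻ A? x∈ in toY (T⊆X x∈T) Ax)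
      (bZ (filter (¬? ∘ A?) T) (Unique-filter⁺ (¬? ∘ A?) uniq)
        λ x∈ → let x∈T , ¬Ax = ∈-filter⁻ (¬? ∘ A?) x∈ in toZ (T⊆X x∈T) ¬Ax))

  bound-singleton : ∀ x → Bound (_≡ x) 1
  bound-singleton x [] uniq T⊆ = z≤n
  bound-singleton x (y ∷ []) uniq T⊆ = s≤s z≤n
  bound-singleton x (y ∷ z ∷ T) ((y≢z ∷ _) ∷ _) T⊆ =
    contradiction (trans (T⊆ (here refl)) (≡-sym (T⊆ (there (here refl))))) y≢z

  bound-list : ∀ L → Bound (_∈ L) (length L)
  bound-list [] [] uniq T⊆ = z≤n
  bound-list [] (y ∷ T) uniq T⊆ = case T⊆ (here refl) of λ ()
  bound-list (x ∷ L) = bound-∪ (_≟ⱽ x) (λ _ x≡y → x≡y)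
    (λ { (here x≡y) x≢y → contradiction x≡y x≢y ; (there y∈L) _ → y∈L })
    (bound-singleton x) (bound-list L)

  bound-concat : ∀ {u} Ps {X : V → Set} → (∀ {x} → X x → Any (x ∈_) Ps) →
                 (∀ {P} → P ∈ Ps → Bound (_∈ P) u) → Bound X (length Ps * u)
  bound-concat [] cover bP [] uniq T⊆ = z≤n
  bound-concat [] cover bP (x ∷ T) uniq T⊆ = case cover (T⊆ (here refl)) of λ ()
  bound-concat (P ∷ Ps) {X} cover bP =
    bound-∪ {Z = λ x → Any (x ∈_) Ps} (_∈? P) (λ _ x∈P → x∈P)
      (λ Xx x∉P → case cover Xx of λ { (here x∈P) → contradiction x∈P x∉P ; (there x∈) → x∈ })
      (bP (here refl)) (bound-concat Ps id (bP ∘ there))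

odd≢even : ∀ e m → suc (m + m) ≢ e + e
odd≢even (suc e) zero    eq = case trans (suc-injective eq) (+-suc e e) of λ ()
odd≢even (suc e) (suc m) eq = odd≢even e m
  (suc-injective (trans (≡-sym (cong suc (+-suc m m))) (trans (suc-injective eq) (+-suc e e))))

module Degrees {A : Set} {R : A → A → Set} (R? : ∀ x y → Dec (R x y))
               (R-sym : ∀ {x y} → R x y → R y x) (R-irrefl : ∀ {x} → ¬ R x x) where

  degree : List A → A → ℕ
  degree T x = length (filter (R? x) T)

  degree-sum : List A → List A → ℕ
  degree-sum T L = sum (map (degree T) L)

  degree-sum-∷ : ∀ y T L → degree-sum (y ∷ T) L ≡ degree L y + degree-sum T L
  degree-sum-∷ y T [] = refl
  degree-sum-∷ y T (x ∷ L) with R? x y | R? y x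
  ... | yes _ | yes _ = cong suc (trans (cong (degree T x +_) (degree-sum-∷ y T L)) (x∙yz≈y∙xz (degree T x) (degree L y) (degree-sum T L)))
  ... | no _  | no _  = trans (cong (degree T x +_) (degree-sum-∷ y T L)) (x∙yz≈y∙xz (degree T x) (degree L y) (degree-sum T L))
  ... | yes e | no ¬e = contradiction (R-sym e) ¬e
  ... | no ¬e | yes e = contradiction (R-sym e) ¬e

  degree-irrefl : ∀ y T → degree (y ∷ T) y ≡ degree T y
  degree-irrefl y T with R? y y
  ... | yes e = contradiction e R-irrefl
  ... | no _  = refl

  -- The new vertex `y` contributes its degree twice: once as its own, once as an additional
  -- neighbour of the vertices adjacent to it.
  handshake : ∀ T → ∃ λ e → degree-sum T T ≡ e + e
  handshake [] = 0 , refl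
  handshake (y ∷ T) with handshake T
  ... | e , eq = degree T y + e , (begin
    degree (y ∷ T) y + degree-sum (y ∷ T) T
      ≡⟨ cong₂ _+_ (degree-irrefl y T) (degree-sum-∷ y T T) ⟩
    degree T y + (degree T y + degree-sum T T)
      ≡⟨ cong (λ m → degree T y + (degree T y + m)) eq ⟩
    degree T y + (degree T y + (e + e))
      ≡⟨ rearrange (degree T y) e ⟩
    (degree T y + e) + (degree T y + e) ∎)
    where
    open ≡-Reasoning
    rearrange : ∀ d e → d + (d + (e + e)) ≡ (d + e) + (d + e)
    rearrange = solve-∀

  regular-sum : ∀ {d} T L → (∀ {x} → x ∈ L → degree T x ≡ d) → degree-sum T L ≡ length L * d
  regular-sum T [] reg = refl
  regular-sum T (x ∷ L) reg = cong₂ _+_ (reg (here refl)) (regular-sum T L (reg ∘ there))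

-- Gallai partitions

module Gallai-structure {N k : ℕ} (c : Colouring N k) (gal : Gallai c) where

  V C : Set
  V = Fin N
  C = Fin k

  open Bounds {V} _≟_ public

  -- Distinctness is included because `col` is arbitrary on the diagonal.
  Edge : C → V → V → Set
  Edge a x y = x ≢ y × col c x y ≡ a

  Edge? : ∀ a x y → Dec (Edge a x y)
  Edge? a x y = ¬? (x ≟ y) ×-dec (col c x y ≟ a)

  edge-sym : ∀ {a x y} → Edge a x y → Edge a y x
  edge-sym (x≢y , eq) = x≢y ∘ ≡-sym , trans (≡-sym (Colouring.sym c _ _ x≢y)) eq

  edge-irrefl : ∀ {a x} → ¬ Edge a x x
  edge-irrefl (x≢x , _) = x≢x refl

  edge-unique : ∀ {a b x y} → Edge a x y → Edge b x y → a ≡ b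
  edge-unique (_ , eq) (_ , eq′) = trans (≡-sym eq) eq′

  gallai-triangle : ∀ {a b d x y z} → Edge a x y → Edge b y z → Edge d x z →
                    a ≡ b ⊎ b ≡ d ⊎ a ≡ d
  gallai-triangle {a} {b} {d} {x} {y} {z} (x≢y , refl) (y≢z , refl) (x≢z , refl) with a ≟ b | b ≟ d | a ≟ d
  ... | yes p | _ | _ = inj₁ p
  ... | no _ | yes p | _ = inj₂ (inj₁ p)
  ... | no _ | no _ | yes p = inj₂ (inj₂ p)
  ... | no p | no q | no r = contradiction (x≢y , y≢z , x≢z , p , q , r) (gal x y z)

  Edge₂ : C → C → V → V → Set
  Edge₂ a b x y = Edge a x y ⊎ Edge b x y

  Edge₂? : ∀ a b x y → Dec (Edge₂ a b x y)
  Edge₂? a b x y = Edge? a x y ⊎-dec Edge? b x y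

  edge₂-sym : ∀ {a b x y} → Edge₂ a b x y → Edge₂ a b y x
  edge₂-sym = ⊎-map edge-sym edge-sym

  record Cut (G : V → V → Set) (S : List V) : Set₁ where
    field
      Side  : V → Set
      side? : Decidable Side
      {u w} : V
      u∈S   : u ∈ S
      u∈    : Side u
      w∈S   : w ∈ S
      w∉    : ¬ Side w
      cross : ∀ {x y} → x ∈ S → y ∈ S → Side x → ¬ Side y → G x y

  cut-map : ∀ {G H : V → V → Set} {S} → (∀ {x y} → G x y → H x y) → Cut G S → Cut H S
  cut-map f κ = record
    { side? = side? ; u∈S = u∈S ; u∈ = u∈ ; w∈S = w∈S ; w∉ = w∉
    ; cross = λ x∈ y∈ sx sy → f (cross x∈ y∈ sx sy) }
    where open Cut κ

  Crossing : C → C → List V → List V → Set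
  Crossing a b P Q = ∀ {x y} → x ∈ P → y ∈ Q → Edge₂ a b x y

  crossing-sym : ∀ {a b P Q} → Crossing a b P Q → Crossing a b Q P
  crossing-sym f x∈ y∈ = edge₂-sym (f y∈ x∈)

  -- The refinement is maximal: `indec` is what makes each vertex outside a part see it in a single
  -- colour.
  record Parts (a b : C) (S : List V) : Set₁ where
    field
      parts     : List (List V)
      cover     : ∀ {x} → x ∈ S → Any (x ∈_) parts
      part⊆     : ∀ {P} → P ∈ parts → P ⊆ S
      crossing  : AllPairs (Crossing a b) parts
      inhabited : ∀ {P} → P ∈ parts → ∃ (_∈ P)
      indec     : ∀ {P} → P ∈ parts → ¬ Cut (Edge₂ a b) P

  -- Whether a cut exists is not decided, so the refinement is obtained under double negation, which
  -- suffices for stable goals. The recursion runs on `n`, as both sides of a cut are strictly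
  -- shorter than `S`.
  refine : ∀ {a b} n S → length S ≤ n → ∃ (_∈ S) → ¬ ¬ Parts a b S
  refine n [] _ (_ , ()) _
  refine {a} {b} (suc n) S@(_ ∷ _) len inh k = ¬¬-excluded-middle λ
    { (no indec) → k record
        { parts = S ∷ []
        ; cover = here
        ; part⊆ = λ { (here refl) → id }
        ; crossing = [] ∷ []
        ; inhabited = λ { (here refl) → inh }
        ; indec = λ { (here refl) → indec } }
    ; (yes κ) → let open Cut κ in
        refine n (filter side? S)
          (s≤s⁻¹ (≤-trans (filter-notAll side? S (lose w∈S w∉)) len))
          (_ , ∈-filter⁺ side? u∈S u∈) λ P₁ →
        refine n (filter (¬? ∘ side?) S)
          (s≤s⁻¹ (≤-trans (filter-notAll (¬? ∘ side?) S (lose u∈S λ ¬u → ¬u u∈)) len))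
          (_ , ∈-filter⁺ (¬? ∘ side?) w∈S w∉) λ P₂ →
        k (glue κ P₁ P₂) }
    where
    glue : (κ : Cut (Edge₂ a b) S) → let open Cut κ in
           Parts a b (filter side? S) → Parts a b (filter (¬? ∘ side?) S) → Parts a b S
    glue κ P₁ P₂ = record
      { parts = parts P₁ ++ parts P₂
      ; cover = λ {x} x∈ → case side? x of λ
          { (yes s) → Any.++⁺ˡ (cover P₁ (∈-filter⁺ side? x∈ s))
          ; (no ¬s) → Any.++⁺ʳ (parts P₁) (cover P₂ (∈-filter⁺ (¬? ∘ side?) x∈ ¬s)) }
      ; part⊆ = λ P∈ x∈ → case ∈-++⁻ (parts P₁) P∈ of λ
          { (inj₁ P∈₁) → proj₁ (side₁ P∈₁ x∈)
          ; (inj₂ P∈₂) → proj₁ (side₂ P∈₂ x∈) }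
      ; crossing = AllPairs.++⁺ (crossing P₁) (crossing P₂)
          (All.tabulate λ P∈₁ → All.tabulate λ P∈₂ x∈ y∈ →
            let x∈S , sx = side₁ P∈₁ x∈ ; y∈S , sy = side₂ P∈₂ y∈ in cross x∈S y∈S sx sy)
      ; inhabited = λ P∈ → [ inhabited P₁ , inhabited P₂ ]′ (∈-++⁻ (parts P₁) P∈)
      ; indec = λ P∈ → [ indec P₁ , indec P₂ ]′ (∈-++⁻ (parts P₁) P∈) }
      where
      open Cut κ
      open Parts
      side₁ : ∀ {P x} → P ∈ parts P₁ → x ∈ P → x ∈ S × Side x
      side₁ P∈ x∈ = ∈-filter⁻ side? (part⊆ P₁ P∈ x∈)
      side₂ : ∀ {P x} → P ∈ parts P₂ → x ∈ P → x ∈ S × ¬ Side x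
      side₂ P∈ x∈ = ∈-filter⁻ (¬? ∘ side?) (part⊆ P₂ P∈ x∈)

  allPairs-lookup : ∀ {A : Set} {R : A → A → Set} → (∀ {x y} → R x y → R y x) →
                    ∀ {xs x y} → AllPairs R xs → x ∈ xs → y ∈ xs → x ≡ y ⊎ R x y
  allPairs-lookup R-sym (_ ∷ _) (here refl) (here refl) = inj₁ refl
  allPairs-lookup R-sym (r ∷ _) (here refl) (there y∈) = inj₂ (All.lookup r y∈)
  allPairs-lookup R-sym (r ∷ _) (there x∈) (here refl) = inj₂ (R-sym (All.lookup r x∈))
  allPairs-lookup R-sym (_ ∷ rs) (there x∈) (there y∈) = allPairs-lookup R-sym rs x∈ y∈

  -- If `z` saw both colours in `P`, its `r`-neighbours would form one side of a cut of `P`: an edge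
  -- from an `r`-neighbour to a `b`-neighbour of `z` has colour `r` or `b`, since the triangle with
  -- `z` is not rainbow.
  indec-uniform : ∀ {r b P z} → r ≢ b → ¬ Cut (Edge₂ r b) P → (∀ {y} → y ∈ P → Edge₂ r b z y) →
                  ∀ {y y′} → y ∈ P → y′ ∈ P → Edge r z y → ¬ Edge b z y′
  indec-uniform {r} {b} {P} {z} r≢b indec zP {y} {y′} y∈ y′∈ zy zy′ = indec record
    { Side = Edge r z ; side? = Edge? r z
    ; u∈S = y∈ ; u∈ = zy ; w∈S = y′∈ ; w∉ = λ e → r≢b (edge-unique e zy′)
    ; cross = across }
    where
    across : ∀ {x x′} → x ∈ P → x′ ∈ P → Edge r z x → ¬ Edge r z x′ → Edge₂ r b x x′
    across {x} {x′} x∈ x′∈ zx ¬zx′ with zP x′∈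
    ... | inj₁ e = contradiction e ¬zx′
    ... | inj₂ zx′ with gallai-triangle zx ((λ { refl → ¬zx′ zx }) , refl) zx′
    ...   | inj₁ eq = inj₁ ((λ { refl → ¬zx′ zx }) , ≡-sym eq)
    ...   | inj₂ (inj₁ eq) = inj₂ ((λ { refl → ¬zx′ zx }) , eq)
    ...   | inj₂ (inj₂ eq) = contradiction eq r≢b

  module PartsLemmas {r b : C} {S : List V} (Π : Parts r b S) where
    open Parts Π public

    part-of : ∀ {x} → x ∈ S → ∃ λ P → P ∈ parts × x ∈ P
    part-of x∈ = find (cover x∈)

    same⊎cross : ∀ {P Q} → P ∈ parts → Q ∈ parts → P ≡ Q ⊎ Crossing r b P Q
    same⊎cross = allPairs-lookup crossing-sym crossing

    outside : ∀ {P z} → P ∈ parts → z ∈ S → z ∉ P → ∀ {x} → x ∈ P → Edge₂ r b z x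
    outside P∈ z∈S z∉P x∈ with part-of z∈S
    ... | Q , Q∈ , z∈Q with same⊎cross Q∈ P∈
    ...   | inj₁ refl = contradiction z∈Q z∉P
    ...   | inj₂ cr = cr z∈Q x∈

    uniform : r ≢ b → ∀ {P z} → P ∈ parts → z ∈ S → z ∉ P →
              ∀ {x y} → x ∈ P → y ∈ P → Edge r z x → ¬ Edge b z y
    uniform r≢b P∈ z∈S z∉P = indec-uniform r≢b (indec P∈) (outside P∈ z∈S z∉P)

    -- A part that filled `S` would inherit the cut of `S`, against indecomposability.
    proper : Cut (Edge₂ r b) S → ∀ {P} → P ∈ parts → ∃ λ z → z ∈ S × z ∉ P
    proper κ {P} P∈ with Any.any? (¬? ∘ (_∈? P)) S
    ... | yes z∈ = find z∈
    ... | no ¬∃ = contradiction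
        (record { side? = side? ; u∈S = S⊆P u∈S ; u∈ = u∈ ; w∈S = S⊆P w∈S ; w∉ = w∉
                ; cross = λ x∈ y∈ → cross (part⊆ P∈ x∈) (part⊆ P∈ y∈) })
        (indec P∈)
      where
      open Cut κ
      S⊆P : S ⊆ P
      S⊆P {x} x∈ = decidable-stable (x ∈? P) λ x∉ → ¬∃ (lose x∈ x∉)

    other : Cut (Edge₂ r b) S → ∀ {P} → P ∈ parts → ∃ λ Q → Q ∈ parts × Crossing r b Q P
    other κ {P} P∈ with proper κ P∈
    ... | z , z∈S , z∉P with part-of z∈S
    ...   | Q , Q∈ , z∈Q with same⊎cross Q∈ P∈
    ...     | inj₁ refl = contradiction z∈Q z∉P
    ...     | inj₂ cr = Q , Q∈ , cr

  -- A vertex v is inserted into a set that already has a two-coloured cut.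
  -- If v meets some indecomposable part in the two colours only, that part is cut off.
  -- Otherwise v sends a third colour c to every part, and no other new colour;
  -- if both r and b also occurred at v, the parts they lead to would be joined to
  -- another part in both colours.  So v uses at most two colours and {v} is cut off.
  module Insert {r b : C} {v : V} {S : List V} (v∉S : v ∉ S) {v₀ : V} (v₀∈S : v₀ ∈ S)
                (κ : Cut (Edge₂ r b) S) (Π : Parts r b S)
                (noCut : ∀ {a d} → ¬ Cut (Edge₂ a d) (v ∷ S)) where
    open PartsLemmas Π

    v-cut : ∀ {a d} → ¬ (∀ {y} → y ∈ S → Edge₂ a d v y)
    v-cut f = noCut record
      { side? = _≟ v ; u∈S = here refl ; u∈ = refl ; w∈S = there v₀∈S ; w∉ = λ { refl → v∉S v₀∈S }
      ; cross = λ { x∈ (here refl) refl y≢v → contradiction refl y≢v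
                  ; x∈ (there y∈) refl y≢v → f y∈ } }

    untouched : ∀ {P} → P ∈ parts → ¬ (∀ {y} → y ∈ P → Edge₂ r b v y)
    untouched {P} P∈ f = noCut record
      { side? = _∈? P ; u∈S = there (part⊆ P∈ p∈) ; u∈ = p∈ ; w∈S = here refl ; w∉ = v∉S ∘ part⊆ P∈
      ; cross = λ { _ (here refl) x∈P _ → edge₂-sym (f x∈P)
                  ; _ (there y∈) x∈P y∉P → edge₂-sym (outside P∈ y∈ y∉P x∈P) } }
      where p∈ = proj₂ (inhabited P∈)

    touched : ∀ {P} → P ∈ parts → ∃ λ x → x ∈ P × ¬ Edge₂ r b v x
    touched {P} P∈ with Any.any? (¬? ∘ Edge₂? r b v) P
    ... | yes x∈ = find x∈
    ... | no ¬∃ = contradiction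
      (λ {y} y∈ → decidable-stable (Edge₂? r b v y) λ ¬e → ¬∃ (lose y∈ ¬e)) (untouched P∈)

    v≢ : ∀ {y} → y ∈ S → v ≢ y
    v≢ y∈ refl = v∉S y∈

    third-across : ∀ {x y} → x ∈ S → y ∈ S → Edge₂ r b x y →
                   ¬ Edge₂ r b v x → ¬ Edge₂ r b v y → col c v x ≡ col c v y
    third-across {x} {y} x∈ y∈ xy ¬x ¬y = [ (λ e → go e inj₁) , (λ e → go e inj₂) ]′ xy
      where
      go : ∀ {a} → Edge a x y → (∀ {z} → Edge a v z → Edge₂ r b v z) → col c v x ≡ col c v y
      go e inj with gallai-triangle (v≢ x∈ , refl) e (v≢ y∈ , refl)
      ... | inj₁ eq = contradiction (inj (v≢ x∈ , eq)) ¬x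
      ... | inj₂ (inj₁ eq) = contradiction (inj (v≢ y∈ , ≡-sym eq)) ¬y
      ... | inj₂ (inj₂ eq) = eq

    third-unique : ∀ {y y′} → y ∈ S → y′ ∈ S → ¬ Edge₂ r b v y → ¬ Edge₂ r b v y′ → col c v y ≡ col c v y′
    third-unique y∈ y′∈ ¬y ¬y′ with part-of y∈ | part-of y′∈
    ... | P , P∈ , y∈P | P′ , P′∈ , y′∈P′ with same⊎cross P∈ P′∈
    ...   | inj₂ cr = third-across y∈ y′∈ (cr y∈P y′∈P′) ¬y ¬y′
    -- Two vertices of the same part are both compared with a touched vertex of another part.
    ...   | inj₁ refl with other κ P∈
    ...     | Q , Q∈ , cr with touched Q∈
    ...       | x , x∈Q , ¬x = trans
      (≡-sym (third-across (part⊆ Q∈ x∈Q) y∈ (cr x∈Q y∈P) ¬x ¬y))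
      (third-across (part⊆ Q∈ x∈Q) y′∈ (cr x∈Q y′∈P′) ¬x ¬y′)

    third : C
    third = col c v (proj₁ (touched (proj₁ (proj₂ (part-of v₀∈S)))))

    colours : ∀ {y} → y ∈ S → Edge₂ r b v y ⊎ Edge third v y
    colours {y} y∈ with Edge₂? r b v y
    ... | yes e = inj₁ e
    ... | no ¬y with part-of v₀∈S
    ...   | P , P∈ , _ with touched P∈
    ...     | x , x∈P , ¬x = inj₂ (v≢ y∈ , third-unique y∈ (part⊆ P∈ x∈P) ¬y ¬x)

    -- The edge `v x` has a third colour, which neither of the other two sides of the triangle has,
    -- so those two sides agree.
    force : ∀ {a} → (∀ {x y} → Edge a x y → Edge₂ r b x y) → ∀ {x y} → x ∈ S → y ∈ S →
            Edge₂ r b x y → ¬ Edge₂ r b v x → Edge a v y → Edge a x y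
    force inj {x} x∈ y∈ xy ¬x vy with [ proj₁ , proj₁ ]′ xy
    ... | x≢y with gallai-triangle (v≢ x∈ , refl) (x≢y , refl) vy
    ...   | inj₁ eq = contradiction (⊎-map (λ e → v≢ x∈ , trans eq (proj₂ e)) (λ e → v≢ x∈ , trans eq (proj₂ e)) xy) ¬x
    ...   | inj₂ (inj₁ eq) = x≢y , eq
    ...   | inj₂ (inj₂ eq) = contradiction (inj (v≢ x∈ , eq)) ¬x

    r≢b : r ≢ b
    r≢b refl = v-cut λ y∈ → case colours y∈ of λ
      { (inj₁ (inj₁ e)) → inj₁ e ; (inj₁ (inj₂ e)) → inj₁ e ; (inj₂ e) → inj₂ e }

    r-edge : ∃ λ y → y ∈ S × Edge r v y
    r-edge with Any.any? (Edge? r v) S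
    ... | yes y∈ = find y∈
    ... | no ¬∃ = ⊥-elim $ v-cut λ y∈ → case colours y∈ of λ
      { (inj₁ (inj₁ e)) → contradiction (lose y∈ e) ¬∃ ; (inj₁ (inj₂ e)) → inj₁ e ; (inj₂ e) → inj₂ e }

    b-edge : ∃ λ y → y ∈ S × Edge b v y
    b-edge with Any.any? (Edge? b v) S
    ... | yes y∈ = find y∈
    ... | no ¬∃ = ⊥-elim $ v-cut λ y∈ → case colours y∈ of λ
      { (inj₁ (inj₂ e)) → contradiction (lose y∈ e) ¬∃ ; (inj₁ (inj₁ e)) → inj₁ e ; (inj₂ e) → inj₂ e }

    absurd : ⊥
    absurd with r-edge | b-edge
    ... | y , y∈ , vy | y′ , y′∈ , vy′ with part-of y∈ | part-of y′∈
    ...   | P , P∈ , y∈P | P′ , P′∈ , y′∈P′ with same⊎cross P∈ P′∈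
    ...     | inj₁ refl with other κ P∈
    ...       | Q , Q∈ , cr with touched Q∈
    ...         | x , x∈Q , ¬x = uniform r≢b P∈ (part⊆ Q∈ x∈Q)
      (λ x∈P → [ edge-irrefl , edge-irrefl ]′ (cr x∈Q x∈P)) y∈P y′∈P′
      (force inj₁ (part⊆ Q∈ x∈Q) y∈ (cr x∈Q y∈P) ¬x vy)
      (force inj₂ (part⊆ Q∈ x∈Q) y′∈ (cr x∈Q y′∈P′) ¬x vy′)
    absurd | y , y∈ , vy | y′ , y′∈ , vy′ | P , P∈ , y∈P | P′ , P′∈ , y′∈P′ | inj₂ cr
      with touched P∈ | touched P′∈
    -- By `force`, `x` sees `y′` in `b` and `x′` sees `y` in `r`. If `x x′` has colour `r`, then `x`
    -- sees both colours in `P′`; if it has colour `b`, then `x′` sees both in `P`.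
    ... | x , x∈P , ¬x | x′ , x′∈P′ , ¬x′ with cr x∈P x′∈P′
    ...   | inj₁ xx′ = uniform r≢b P′∈ (part⊆ P∈ x∈P)
      (λ x∈P′ → [ edge-irrefl , edge-irrefl ]′ (cr x∈P x∈P′)) x′∈P′ y′∈P′ xx′
      (force inj₂ (part⊆ P∈ x∈P) y′∈ (cr x∈P y′∈P′) ¬x vy′)
    ...   | inj₂ xx′ = uniform r≢b P∈ (part⊆ P′∈ x′∈P′)
      (λ x′∈P → [ edge-irrefl , edge-irrefl ]′ (cr x′∈P x′∈P′)) y∈P x∈P
      (force inj₁ (part⊆ P′∈ x′∈P′) y∈ (edge₂-sym (cr y∈P x′∈P′)) ¬x′ vy)
      (edge-sym xx′)

  -- Gallai's structure theorem in the form of a cut, by inserting the vertices one at a time: the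
  -- cut of the tail is refined to `Parts`, and `Insert.absurd` then yields a cut of the whole list.
  gallai-cut : ∀ {v w S} → Unique (v ∷ w ∷ S) → ¬ (∀ {a b} → ¬ Cut (Edge₂ a b) (v ∷ w ∷ S))
  gallai-cut {v} {w} {[]} ((v≢w ∷ []) ∷ _) noCut = noCut {col c v w} {col c v w} record
    { side? = _≟ v ; u∈S = here refl ; u∈ = refl ; w∈S = there (here refl) ; w∉ = v≢w ∘ ≡-sym
    ; cross = λ { x∈ (here refl) refl y≢v → contradiction refl y≢v
                ; x∈ (there (here refl)) refl y≢v → inj₁ (v≢w , refl) } }
  gallai-cut {v} {w} {S@(_ ∷ _)} (v∉ ∷ uniq) noCut = gallai-cut uniq λ κ →
    refine _ (w ∷ S) ≤-refl (_ , here refl) λ Π →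
      Insert.absurd (λ v∈ → All.lookup v∉ v∈ refl) (here refl) κ Π noCut

  -- Two-colour Ramsey bounds

  -- Nested so that applying it to a vertex gives the smaller clique condition on its neighbourhood,
  -- which is the step of the Ramsey recursion.
  NoClique : ℕ → C → (V → Set) → Set
  NoClique zero    a X = ⊥
  NoClique (suc n) a X = ∀ {x} → X x → NoClique n a (λ y → X y × Edge a x y)

  noClique-⊆ : ∀ n {a} {X Y : V → Set} → (∀ {x} → Y x → X x) → NoClique n a X → NoClique n a Y
  noClique-⊆ (suc n) Y⊆X K y∈ = noClique-⊆ n (λ (z∈ , e) → Y⊆X z∈ , e) (K (Y⊆X y∈))

  noClique-stable : ∀ n {a X} → Stable (NoClique n a X)
  noClique-stable zero ¬¬K = ¬¬K id
  noClique-stable (suc n) ¬¬K x∈ = noClique-stable n λ ¬K → ¬¬K λ K → ¬K (K x∈)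

  TwoColoured : C → C → (V → Set) → Set
  TwoColoured r b X = ∀ {x y} → X x → X y → x ≢ y → Edge₂ r b x y

  restrict : ∀ {r b} {X Y : V → Set} → (∀ {x} → Y x → X x) → TwoColoured r b X → TwoColoured r b Y
  restrict Y⊆X two x∈ y∈ = two (Y⊆X x∈) (Y⊆X y∈)

  swap-colours : ∀ {r b X} → TwoColoured r b X → TwoColoured b r X
  swap-colours two x∈ y∈ x≢y = ⊎-swap (two x∈ y∈ x≢y)

  ramsey-2 : ∀ n {r b X} → TwoColoured r b X → NoClique 2 r X → NoClique (suc n) b X → Bound X n
  ramsey-2 n two Kr Kb [] uniq T⊆ = z≤n
  ramsey-2 zero two Kr Kb (x ∷ T) uniq T⊆ = ⊥-elim (Kb (T⊆ (here refl)))
  ramsey-2 (suc n) {r} {b} two Kr Kb (x ∷ T) (x∉ ∷ uniq) T⊆ = s≤s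
    (ramsey-2 n (restrict proj₁ two)
      (noClique-⊆ 2 proj₁ Kr) (Kb (T⊆ (here refl))) T uniq
      λ y∈ → T⊆ (there y∈) , blue y∈)
    where
    blue : ∀ {y} → y ∈ T → Edge b x y
    blue y∈ with two (T⊆ (here refl)) (T⊆ (there y∈)) (All.lookup x∉ y∈)
    ... | inj₁ e = ⊥-elim (Kr (T⊆ (here refl)) (T⊆ (there y∈) , e))
    ... | inj₂ e = e

  bound-neighbours : ∀ {r b m n X x} → TwoColoured r b X → X x →
    Bound (λ y → X y × Edge r x y) m → Bound (λ y → X y × Edge b x y) n →
    Bound X (1 + (m + n))
  bound-neighbours {r} {b} {X = X} {x} two x∈ br bb =
    bound-∪ {Z = λ y → X y × x ≢ y} (_≟ x) (λ _ y≡x → y≡x) (λ y∈ y≢x → y∈ , y≢x ∘ ≡-sym)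
      (bound-singleton x)
      (bound-∪ {Y = λ y → X y × Edge r x y} (Edge? r x)
        (λ (y∈ , _) e → y∈ , e)
        (λ (y∈ , x≢y) ¬e → y∈ , [ (λ e → contradiction e ¬e) , id ]′ (two x∈ y∈ x≢y))
        br bb)

  -- The classical recursion for Ramsey numbers: one vertex, its `r`-neighbours and its
  -- `b`-neighbours exhaust the set.
  ramsey-step : ∀ {r b m n X} → TwoColoured r b X →
    (∀ {x} → X x → Bound (λ y → X y × Edge r x y) m) →
    (∀ {x} → X x → Bound (λ y → X y × Edge b x y) n) → Bound X (1 + (m + n))
  ramsey-step two br bb [] uniq T⊆ = z≤n
  ramsey-step two br bb T@(x ∷ _) uniq T⊆ =
    bound-neighbours two (T⊆ (here refl)) (br (T⊆ (here refl))) (bb (T⊆ (here refl))) T uniq T⊆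

  ramsey₃₃ : ∀ {r b X} → TwoColoured r b X → NoClique 3 r X → NoClique 3 b X → Bound X 5
  ramsey₃₃ two Kr Kb = ramsey-step two
    (λ x∈ → ramsey-2 2 (restrict proj₁ two) (Kr x∈) (noClique-⊆ 3 proj₁ Kb))
    (λ x∈ → ramsey-2 2 (swap-colours (restrict proj₁ two)) (Kb x∈) (noClique-⊆ 3 proj₁ Kr))

  -- With nine vertices every red degree would be exactly 3, against the handshake lemma.
  ramsey₃₄ : ∀ {r b X} → TwoColoured r b X → NoClique 3 r X → NoClique 4 b X → Bound X 8
  ramsey₃₄ {r} {b} {X} two Kr Kb T uniq T⊆ with length T ≤? 8
  ... | yes p = p
  ... | no  p = contradiction (trans (≡-sym (trans (regular-sum T T degree≡3) (cong (_* 3) length≡9))) (proj₂ hs))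
                  -- The nine degrees sum to 27 = 1 + (13 + 13).
                  (odd≢even (proj₁ hs) 13)
    where
    open Degrees (Edge? r) edge-sym edge-irrefl
    hs = handshake T
    red-bound : ∀ {x} → X x → Bound (λ y → X y × Edge r x y) 3
    red-bound x∈ = ramsey-2 3 (restrict proj₁ two) (Kr x∈) (noClique-⊆ 4 proj₁ Kb)
    blue-bound : ∀ {x} → X x → Bound (λ y → X y × Edge b x y) 5
    blue-bound x∈ = ramsey₃₃ (restrict proj₁ two) (noClique-⊆ 3 proj₁ Kr) (Kb x∈)
    length≡9 : length T ≡ 9
    length≡9 = ≤-antisym (ramsey-step two red-bound blue-bound T uniq T⊆) (≰⇒> p)
    degree≡3 : ∀ {x} → x ∈ T → degree T x ≡ 3
    degree≡3 {x} x∈ = ≤-antisym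
      (red-bound (T⊆ x∈) (filter (Edge? r x) T) (Unique-filter⁺ (Edge? r x) uniq)
        λ y∈ → let y∈T , e = ∈-filter⁻ (Edge? r x) y∈ in T⊆ y∈T , e)
      -- From 9 ≤ 1 + (degree + 5), as at most five vertices are blue neighbours of `x`.
      (+-cancelʳ-≤ 5 _ _ (s≤s⁻¹ (≤-trans (≰⇒> p)
        (bound-neighbours {X = _∈ T} (restrict T⊆ two) x∈
          (λ U uniqU U⊆ → bound-list _ U uniqU λ y∈ → let y∈T , e = U⊆ y∈ in ∈-filter⁺ (Edge? r x) y∈T e)
          (bound-⊆ (λ (y∈ , e) → T⊆ y∈ , e) ≤-refl (blue-bound (T⊆ x∈)))
          T uniq id))))

  ramsey₄₄ : ∀ {r b X} → TwoColoured r b X → NoClique 4 r X → NoClique 4 b X → Bound X 17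
  ramsey₄₄ two Kr Kb = ramsey-step two
    (λ x∈ → ramsey₃₄ (restrict proj₁ two) (Kr x∈) (noClique-⊆ 4 proj₁ Kb))
    (λ x∈ → ramsey₃₄ (swap-colours (restrict proj₁ two)) (Kb x∈) (noClique-⊆ 4 proj₁ Kr))

  -- One vertex from each part gives a set with edges in `r` and `b` only; the Ramsey bounds for it
  -- bound the number of parts.
  reps : ∀ {r b} Ps → AllPairs (Crossing r b) Ps → (∀ {P} → P ∈ Ps → ∃ (_∈ P)) →
         ∃ λ R → length R ≡ length Ps × AllPairs (Edge₂ r b) R × All (λ x → Any (x ∈_) Ps) R
  reps [] _ _ = [] , refl , [] , []
  reps {r} {b} (P ∷ Ps) (cr ∷ crs) inh with inh (here refl) | reps Ps crs (inh ∘ there)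
  ... | x , x∈P | R , len , pairs , R⊆ = x ∷ R , cong suc len ,
    (All.map (λ y∈ → let _ , Q∈ , y∈Q = find y∈ in All.lookup cr Q∈ x∈P y∈Q) R⊆ ∷ pairs) ,
    here x∈P ∷ All.map there R⊆

  module _ {r b : C} {S : List V} (Π : Parts r b S) where
    open Parts Π

    parts-bound : ∀ {m} → (∀ {X} → (∀ {x} → X x → x ∈ S) → TwoColoured r b X → Bound X m) → length parts ≤ m
    parts-bound ramsey with reps parts crossing inhabited
    ... | R , len , pairs , R⊆ = subst (_≤ _) len
      (ramsey {_∈ R} (λ x∈ → let _ , P∈ , x∈P = find (All.lookup R⊆ x∈) in part⊆ P∈ x∈P)
        two R (AllPairs.map [ proj₁ , proj₁ ]′ pairs) id)
      where
      two : TwoColoured r b (_∈ R)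
      two x∈ y∈ x≢y = [ (λ x≡y → contradiction x≡y x≢y) , id ]′ (allPairs-lookup edge₂-sym pairs x∈ y∈)

  -- Induction on the vertex set

  -- `x` is the vertex of the K₄ that carries the pendant edge `x u`.
  NoK4e : C → (V → Set) → Set
  NoK4e a X = ∀ {x y z w u} → X x → X y → X z → X w → X u →
    Edge a x y → Edge a x z → Edge a x w → Edge a y z → Edge a y w → Edge a z w →
    Edge a x u → u ≢ y → u ≢ z → u ≢ w → ⊥

  -- K₄+e is forbidden in the colours As, K₃ in the colours Bs, and no other colour occurs.
  record Admissible {s t} (As : Vector C s) (Bs : Vector C t) (X : V → Set) : Set where
    field
      covered : ∀ {a x y} → X x → X y → Edge a x y → (∃ λ i → As i ≡ a) ⊎ (∃ λ j → Bs j ≡ a)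
      noK4e   : ∀ i → NoK4e (As i) X
      noK3    : ∀ j → NoClique 3 (Bs j) X

  restrict-adm : ∀ {s t} {As : Vector C s} {Bs : Vector C t} {X Y : V → Set} →
                 (∀ {x} → Y x → X x) → Admissible As Bs X → Admissible As Bs Y
  restrict-adm Y⊆X adm = record
    { covered = λ x∈ y∈ → covered (Y⊆X x∈) (Y⊆X y∈)
    ; noK4e = λ i x y z w u → noK4e i (Y⊆X x) (Y⊆X y) (Y⊆X z) (Y⊆X w) (Y⊆X u)
    ; noK3 = λ j → noClique-⊆ 3 Y⊆X (noK3 j) }
    where open Admissible adm

  index-removeAt : ∀ {A : Set} {n} (xs : Vector A (suc n)) i {a d} → xs i ≡ a → d ≢ a →
                   ∀ j → xs j ≡ d → ∃ λ j′ → removeAt xs i j′ ≡ d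
  index-removeAt xs i xsi≡a d≢a j xsj≡d with i ≟ j
  ... | yes refl = contradiction (trans (≡-sym xsj≡d) xsi≡a) d≢a
  ... | no i≢j = punchOut i≢j , trans (removeAt-punchOut xs i≢j) xsj≡d

  drop₃ : ∀ {s t} {As : Vector C (suc s)} {Bs : Vector C t} {X a} i → As i ≡ a → NoClique 2 a X →
          Admissible As Bs X → Admissible (removeAt As i) Bs X
  drop₃ {As = As} i eq K adm = record
    { covered = λ x∈ y∈ e → [ (λ (j , eq′) → inj₁ (index-removeAt As i eq (λ { refl → K x∈ (y∈ , e) }) j eq′)) , inj₂ ]′
        (covered x∈ y∈ e)
    ; noK4e = noK4e ∘ punchIn i
    ; noK3 = noK3 }
    where open Admissible adm

  -- Weakens a colour: it leaves the list counted by `g` and joins the one counted by `h`.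
  lower₃ : ∀ {s t} {As : Vector C (suc s)} {Bs : Vector C t} {X a} i → As i ≡ a → NoClique 3 a X →
           Admissible As Bs X → Admissible (removeAt As i) (a ∷ᵛ Bs) X
  lower₃ {As = As} {a = a} i eq K adm = record
    { covered = λ {d} x∈ y∈ e → case d ≟ a of λ
        { (yes refl) → inj₂ (0F , refl)
        ; (no d≢a) → [ (λ (j , eq′) → inj₁ (index-removeAt As i eq d≢a j eq′)) , (λ (j , eq′) → inj₂ (Fin.suc j , eq′)) ]′
            (covered x∈ y∈ e) }
    ; noK4e = noK4e ∘ punchIn i
    ; noK3 = λ { 0F → K ; (Fin.suc j) → noK3 j } }
    where open Admissible adm

  drop₂ : ∀ {s t} {As : Vector C s} {Bs : Vector C (suc t)} {X a} j → Bs j ≡ a → NoClique 2 a X →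
          Admissible As Bs X → Admissible As (removeAt Bs j) X
  drop₂ {Bs = Bs} i eq K adm = record
    { covered = λ x∈ y∈ e → [ inj₁ , (λ (j , eq′) → inj₂ (index-removeAt Bs i eq (λ { refl → K x∈ (y∈ , e) }) j eq′)) ]′
        (covered x∈ y∈ e)
    ; noK4e = noK4e
    ; noK3 = noK3 ∘ punchIn i }
    where open Admissible adm

  crossing-swap : ∀ {a b P Q} → Crossing a b P Q → Crossing b a P Q
  crossing-swap cr x∈ y∈ = ⊎-swap (cr x∈ y∈)

  swap-parts : ∀ {r b S} → Parts r b S → Parts b r S
  swap-parts {r} {b} Π = record
    { parts = parts ; cover = cover ; part⊆ = part⊆ ; inhabited = inhabited
    ; crossing = AllPairs.map {R = Crossing r b} {S = Crossing b r} (λ {P} {Q} cr → crossing-swap {r} {b} {P} {Q} cr) crossing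
    ; indec = λ P∈ → indec P∈ ∘ cut-map ⊎-swap }
    where open Parts Π

  fresh-vertex : ∀ {S} → Unique S → ∀ K → length K < length S → ∃ λ u → u ∈ S × u ∉ K
  fresh-vertex {S} uniq K K<S with Any.any? (¬? ∘ (_∈? K)) S
  ... | yes u∈ = find u∈
  ... | no ¬∃ = contradiction (bound-list K S uniq λ {x} x∈ → decidable-stable (x ∈? K) (¬∃ ∘ lose x∈)) (<⇒≱ K<S)

  module Clique₄ {a : C} {x y z w : V} (xy : Edge a x y) (xz : Edge a x z) (xw : Edge a x w)
                 (yz : Edge a y z) (yw : Edge a y w) (zw : Edge a z w) where

    K : List V
    K = x ∷ y ∷ z ∷ w ∷ []

    K-edge : ∀ {v v′} → v ∈ K → v′ ∈ K → v ≢ v′ → Edge a v v′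
    K-edge v∈ v′∈ v≢v′ = [ (λ eq → contradiction eq v≢v′) , id ]′
      (allPairs-lookup edge-sym ((xy ∷ xz ∷ xw ∷ []) ∷ (yz ∷ yw ∷ []) ∷ (zw ∷ []) ∷ [] ∷ []) v∈ v′∈)

  module K4 {a : C} {X : V → Set} {x y z w : V} (noK : NoK4e a X)
            (x∈ : X x) (y∈ : X y) (z∈ : X z) (w∈ : X w)
            (xy : Edge a x y) (xz : Edge a x z) (xw : Edge a x w)
            (yz : Edge a y z) (yw : Edge a y w) (zw : Edge a z w) where
    open Clique₄ xy xz xw yz yw zw public

    -- Each of the four vertices can take the role of the one carrying the pendant edge.
    isolated : ∀ {v u} → v ∈ K → X u → u ∉ K → ¬ Edge a v u
    isolated (here refl) u∈ u∉ vu =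
      noK x∈ y∈ z∈ w∈ u∈ xy xz xw yz yw zw vu
        (u∉ ∘ there ∘ here) (u∉ ∘ there ∘ there ∘ here) (u∉ ∘ there ∘ there ∘ there ∘ here)
    isolated (there (here refl)) u∈ u∉ vu =
      noK y∈ x∈ z∈ w∈ u∈ (edge-sym xy) yz yw xz xw zw vu
        (u∉ ∘ here) (u∉ ∘ there ∘ there ∘ here) (u∉ ∘ there ∘ there ∘ there ∘ here)
    isolated (there (there (here refl))) u∈ u∉ vu =
      noK z∈ x∈ y∈ w∈ u∈ (edge-sym xz) (edge-sym yz) zw xy xw yw vu
        (u∉ ∘ here) (u∉ ∘ there ∘ here) (u∉ ∘ there ∘ there ∘ there ∘ here)
    isolated (there (there (there (here refl)))) u∈ u∉ vu =
      noK w∈ x∈ y∈ z∈ u∈ (edge-sym xw) (edge-sym yw) (edge-sym zw) xy xz yz vu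
        (u∉ ∘ here) (u∉ ∘ there ∘ here) (u∉ ∘ there ∘ there ∘ here)

    K⊆X : ∀ {v} → v ∈ K → X v
    K⊆X = All.lookup (x∈ ∷ y∈ ∷ z∈ ∷ w∈ ∷ [])

  -- `IH` is the induction hypothesis for proper subsets `Y` of `S`, with `z` witnessing properness.
  module Step {S : List V} (uniq : Unique S)
    (IH : ∀ {s t} {As : Vector C s} {Bs : Vector C t} {Y : V → Set} {z} →
          (∀ {x} → Y x → x ∈ S) → z ∈ S → ¬ Y z → Admissible As Bs Y → Bound Y (F s t)) where

    -- If the side has an `a`-edge, an `a`-edge opposite would complete a K₄; so the opposite set
    -- loses `a`, and the side keeps it as a `K3` colour. Otherwise the side loses `a`, and an
    -- `a`-triangle opposite would form a K₄ with `u`. Triangles on the side are excluded by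
    -- assumption, because the opposite set may be empty.
    join-bound : ∀ {s t} {As : Vector C (suc s)} {Bs : Vector C t} {W Side : V → Set} {a u z₁ z₂} i → As i ≡ a →
      Admissible As Bs W → (∀ {x} → W x → x ∈ S) → NoClique 4 a W →
      Decidable Side → W u → Side u → NoClique 3 a (λ x → W x × Side x) →
      (∀ {x y} → W x → W y → Side x → ¬ Side y → Edge a x y) →
      z₁ ∈ S → ¬ (W z₁ × Side z₁) → z₂ ∈ S → ¬ (W z₂ × ¬ Side z₂) →
      Bound W (F s t + F s (suc t))
    join-bound {s} {t} {W = W} {Side} {a} i eq adm W⊆S K₄ side? u∈ us K₃ cross z₁∈ z₁∉ z₂∈ z₂∉ T uT T⊆ =
      by-cases (∃₂ λ x y → (W x × Side x) × (W y × Side y) × Edge a x y)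
        (λ (x , y , (x∈ , sx) , (y∈ , sy) , xy) →
          bound-⊆ id (≤-reflexive (+-comm (F s (suc t)) (F s t)))
            (bound-∪ {Y = λ x → W x × Side x} {Z = λ x → W x × ¬ Side x} side? _,_ _,_
              (IH (W⊆S ∘ proj₁) z₁∈ z₁∉ (lower₃ i eq K₃ (restrict-adm proj₁ adm)))
              (IH (W⊆S ∘ proj₁) z₂∈ z₂∉ (drop₃ i eq
                (noClique-⊆ 2 (λ (v∈ , ¬sv) → (v∈ , cross x∈ v∈ sx ¬sv) , cross y∈ v∈ sy ¬sv) (K₄ x∈ (y∈ , xy)))
                (restrict-adm proj₁ adm))))
            T uT T⊆)
        (λ ¬∃ → bound-∪ {Y = λ x → W x × Side x} {Z = λ x → W x × ¬ Side x} side? _,_ _,_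
              (IH (W⊆S ∘ proj₁) z₁∈ z₁∉ (drop₃ i eq (λ x∈ (y∈ , xy) → ¬∃ (_ , _ , x∈ , y∈ , xy)) (restrict-adm proj₁ adm)))
              (IH (W⊆S ∘ proj₁) z₂∈ z₂∉ (lower₃ i eq
                (noClique-⊆ 3 (λ (v∈ , ¬sv) → v∈ , cross u∈ v∈ us ¬sv) (K₄ u∈))
                (restrict-adm proj₁ adm)))
            T uT T⊆)

    -- The edges of the cut connect `S` in colour `a`, so a K₄ that misses some vertex of `S` would
    -- have an `a`-edge leaving it. Five vertices guarantee a missed one.
    cut-noK4 : ∀ {a} → Cut (Edge a) S → NoK4e a (_∈ S) → 5 ≤ length S → NoClique 4 a (_∈ S)
    cut-noK4 κ noK 5≤S {x} x∈ (y∈ , xy) ((z∈ , xz) , yz) (((w∈ , xw) , yw) , zw) =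
      absurd (side? x) (side? v)
      where
      open Cut κ
      open K4 {X = _∈ S} noK x∈ y∈ z∈ w∈ xy xz xw yz yw zw
      fresh = fresh-vertex uniq K 5≤S
      v = proj₁ fresh
      v∈ = proj₁ (proj₂ fresh)
      v∉ = proj₂ (proj₂ fresh)
      absurd : Dec (Side x) → Dec (Side v) → ⊥
      absurd (yes sx) (no ¬sv) = isolated (here refl) v∈ v∉ (cross x∈ v∈ sx ¬sv)
      absurd (no ¬sx) (yes sv) = isolated (here refl) v∈ v∉ (edge-sym (cross v∈ x∈ sv ¬sx))
      absurd (yes sx) (yes sv) with w ∈? K
      ... | yes w∈K = isolated w∈K v∈ v∉ (edge-sym (cross v∈ w∈S sv w∉))
      ... | no w∉K = isolated (here refl) w∈S w∉K (cross x∈ w∈S sx w∉)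
      absurd (no ¬sx) (no ¬sv) with u ∈? K
      ... | yes u∈K = isolated u∈K v∈ v∉ (cross u∈S v∈ u∈ ¬sv)
      ... | no u∉K = isolated (here refl) u∈S u∉K (edge-sym (cross u∈S x∈ u∈ ¬sx))

    cut-bound₃ : ∀ {s t} {As : Vector C s} {Bs : Vector C t} {a} i → As i ≡ a →
                 Admissible As Bs (_∈ S) → Cut (Edge a) S → length S ≤ F s t
    cut-bound₃ {suc s} {t} i eq adm κ with 5 ≤? length S
    ... | no ¬5≤S = ≤-trans (s≤s⁻¹ (≰⇒> ¬5≤S)) (4≤F s t)
    ... | yes 5≤S = ≤-trans
      (join-bound i eq adm id K₄ side? u∈S u∈
        (noClique-⊆ 3 (λ (x∈ , sx) → x∈ , edge-sym (cross x∈ w∈S sx w∉)) (K₄ w∈S)) cross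
        w∈S (w∉ ∘ proj₂) u∈S (λ (_ , ¬su) → ¬su u∈) S uniq id)
      (split₃ s t)
      where
      open Cut κ
      K₄ = cut-noK4 κ (subst (λ a → NoK4e a (_∈ S)) eq (Admissible.noK4e adm i)) 5≤S

    -- An `a`-edge within one side would form a triangle with any vertex opposite.
    cut-bound₂ : ∀ {s t} {As : Vector C s} {Bs : Vector C t} {a} j → Bs j ≡ a →
                 Admissible As Bs (_∈ S) → Cut (Edge a) S → length S ≤ F s t
    cut-bound₂ {s} {suc t} {a = a} j eq adm κ = ≤-trans
      (bound-∪ {Y = λ x → x ∈ S × Side x} {Z = λ x → x ∈ S × ¬ Side x} side? _,_ _,_
        (IH proj₁ w∈S (w∉ ∘ proj₂) (drop₂ j eq
          (noClique-⊆ 2 (λ (x∈ , sx) → x∈ , edge-sym (cross x∈ w∈S sx w∉)) (K₃ w∈S)) (restrict-adm proj₁ adm)))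
        (IH proj₁ u∈S (λ (_ , ¬su) → ¬su u∈) (drop₂ j eq
          (noClique-⊆ 2 (λ (x∈ , sx) → x∈ , cross u∈S x∈ u∈ sx) (K₃ u∈S)) (restrict-adm proj₁ adm)))
        S uniq id)
      (split₂ s t)
      where
      open Cut κ
      K₃ : NoClique 3 a (_∈ S)
      K₃ = subst (λ a → NoClique 3 a (_∈ S)) eq (Admissible.noK3 adm j)

    cut-bound : ∀ {s t} {As : Vector C s} {Bs : Vector C t} {a} →
                Admissible As Bs (_∈ S) → Cut (Edge a) S → length S ≤ F s t
    cut-bound adm κ = [ (λ (i , eq) → cut-bound₃ i eq adm κ) , (λ (j , eq) → cut-bound₂ j eq adm κ) ]′
      (Admissible.covered adm u∈S w∈S (cross u∈S w∈S u∈ w∉))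
      where open Cut κ

    -- Stated for `r` only; the counterparts for `b` come from exchanging the colours in `κ` and
    -- `Π`.
    module Prime (noCut : ∀ {a} → ¬ Cut (Edge a) S) {r b : C} (κ : Cut (Edge₂ r b) S) (Π : Parts r b S) where
      open PartsLemmas Π public

      r≢b : r ≢ b
      r≢b refl = noCut (cut-map [ id , id ]′ κ)

      -- Otherwise all edges leaving `P` would have colour `b`, a cut in one colour. By `uniform` it
      -- is enough to test one vertex of `P`.
      neighbour : ∀ {P} → P ∈ parts → ∃ λ z → z ∈ S × z ∉ P × (∀ {x} → x ∈ P → Edge r z x)
      neighbour {P} P∈ with Any.any? (λ z → ¬? (z ∈? P) ×-dec Edge? r z (proj₁ (inhabited P∈))) S
      ... | yes z∈ = let z , z∈S , z∉P , zp = find z∈ in z , z∈S , z∉P , λ x∈ →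
        [ id , (λ e → contradiction e (uniform r≢b P∈ z∈S z∉P (proj₂ (inhabited P∈)) x∈ zp)) ]′ (outside P∈ z∈S z∉P x∈)
      ... | no ¬∃ = ⊥-elim (noCut record
        { side? = _∈? P ; u∈S = part⊆ P∈ p∈P ; u∈ = p∈P ; w∈S = z∈S ; w∉ = z∉P
        ; cross = λ _ y∈ x∈P y∉P → edge-sym (all-blue y∈ y∉P x∈P) })
        where
        p∈P = proj₂ (inhabited P∈)
        z∈S = proj₁ (proj₂ (proper κ P∈))
        z∉P = proj₂ (proj₂ (proper κ P∈))
        all-blue : ∀ {x y} → y ∈ S → y ∉ P → x ∈ P → Edge b y x
        all-blue y∈ y∉P x∈P with outside P∈ y∈ y∉P x∈P | outside P∈ y∈ y∉P p∈P
        ... | inj₂ e | _ = e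
        ... | inj₁ _ | inj₁ yp = contradiction (lose y∈ (y∉P , yp)) ¬∃
        ... | inj₁ yx | inj₂ yp = contradiction yp (uniform r≢b P∈ y∈ y∉P x∈P p∈P yx)

      some-edge : ∃₂ λ x y → x ∈ S × y ∈ S × Edge r x y
      some-edge with part-of (Cut.u∈S κ)
      ... | P , P∈ , u∈P = let z , z∈S , _ , e = neighbour P∈ in z , _ , z∈S , part⊆ P∈ u∈P , e u∈P

      -- A common `r`-neighbour of the part extends every `r`-clique in it.
      part-clique : ∀ n {P} → P ∈ parts → NoClique (suc n) r (_∈ S) → NoClique n r (_∈ P)
      part-clique n P∈ K = let z , z∈S , _ , e = neighbour P∈ in
        noClique-⊆ n (λ x∈ → part⊆ P∈ x∈ , e x∈) (K z∈S)

      noK4 : NoK4e r (_∈ S) → 5 ≤ length S → NoClique 4 r (_∈ S)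
      noK4 noK 5≤S x∈ (y∈ , xy) ((z∈ , xz) , yz) (((w∈ , xw) , yw) , zw) = noCut {b} record
        { side? = _∈? K ; u∈S = x∈ ; u∈ = here refl
        ; w∈S = proj₁ (proj₂ fresh) ; w∉ = proj₂ (proj₂ fresh) ; cross = across }
        where
        open K4 {X = _∈ S} noK x∈ y∈ z∈ w∈ xy xz xw yz yw zw
        fresh = fresh-vertex uniq K 5≤S
        -- A part containing all of `K` would have an `r`-neighbour, and with it a pendant edge at
        -- `K`.
        leaves : ∀ {P} → P ∈ parts → ∃ λ v → v ∈ K × v ∉ P
        leaves {P} P∈ with Any.any? (¬? ∘ (_∈? P)) K
        ... | yes v∈ = find v∈
        ... | no ¬∃ = let z , z∈S , z∉P , e = neighbour P∈ in
          contradiction (edge-sym (e (K⊆P (here refl)))) (isolated (here refl) z∈S (z∉P ∘ K⊆P))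
          where
          K⊆P : K ⊆ P
          K⊆P {v} v∈ = decidable-stable (v ∈? P) (¬∃ ∘ lose v∈)
        across : ∀ {v u} → v ∈ S → u ∈ S → v ∈ K → u ∉ K → Edge b v u
        across {v} {u} v∈ u∈ v∈K u∉K with part-of v∈
        ... | P , P∈ , v∈P with u ∈? P
        ...   | no u∉P = [ (λ e → contradiction (edge-sym e) (isolated v∈K u∈ u∉K)) , edge-sym ]′ (outside P∈ u∈ u∉P v∈P)
        -- `v′` sees `v` in `r`, as both lie in `K`, but can see `u` only in `b`, although `u` and
        -- `v` share the part `P`.
        ...   | yes u∈P = let v′ , v′∈K , v′∉P = leaves P∈ in
          [ (λ e → contradiction e (isolated v′∈K u∈ u∉K))
          , (λ e → contradiction e (uniform r≢b P∈ (K⊆X v′∈K) v′∉P v∈P u∈P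
              (K-edge v′∈K v∈K λ { refl → v′∉P v∈P }))) ]′ (outside P∈ (K⊆X v′∈K) v′∉P u∈P)

    module PrimeCases (noCut : ∀ {a} → ¬ Cut (Edge a) S) {r b : C} (κ : Cut (Edge₂ r b) S) (Π : Parts r b S) where
      open Prime noCut κ Π
      private module Swapped = Prime noCut (cut-map ⊎-swap κ) (swap-parts Π)

      sum-parts : ∀ {m u n} → (∀ {X} → (∀ {x} → X x → x ∈ S) → TwoColoured r b X → Bound X m) →
                  (∀ {P} → P ∈ parts → Bound (_∈ P) u) → m * u ≤ n → length S ≤ n
      sum-parts ramsey bP mu≤n = ≤-trans
        (bound-concat parts cover bP S uniq id)
        (≤-trans (*-monoˡ-≤ _ (parts-bound Π ramsey)) mu≤n)

      part-IH : ∀ {s t} {As : Vector C s} {Bs : Vector C t} {P} → P ∈ parts →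
                Admissible As Bs (_∈ P) → Bound (_∈ P) (F s t)
      part-IH P∈ = let z , z∈S , z∉P = proper κ P∈ in IH (part⊆ P∈) z∈S z∉P

      split-at : ∀ {P x₀ m n p} → P ∈ parts → x₀ ∈ P → Bound (_∈ P) p →
                 Bound (λ y → y ∈ S × Edge r x₀ y × y ∉ P) m → Bound (λ y → y ∈ S × Edge b x₀ y × y ∉ P) n → length S ≤ p + (m + n)
      split-at {P} {x₀} P∈ x₀∈ bP br bb =
        bound-∪ {X = _∈ S} {Z = λ y → y ∈ S × y ∉ P} (_∈? P) (λ _ y∈P → y∈P) _,_ bP
          (bound-∪ {Y = λ y → y ∈ S × Edge r x₀ y × y ∉ P} (Edge? r x₀)
            (λ (y∈ , y∉P) e → y∈ , e , y∉P)
            (λ (y∈ , y∉P) ¬e → y∈ , [ (λ e → contradiction (edge-sym e) ¬e) , edge-sym ]′ (outside P∈ y∈ y∉P x₀∈) , y∉P)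
            br bb) S uniq id

      red-of-part : ∀ {P x₀ x y} → P ∈ parts → x₀ ∈ P → x ∈ P → y ∈ S → y ∉ P → Edge r x₀ y → Edge r x y
      red-of-part P∈ x₀∈ x∈ y∈ y∉P e =
        [ edge-sym , (λ e′ → contradiction e′ (uniform r≢b P∈ y∈ y∉P x₀∈ x∈ (edge-sym e))) ]′ (outside P∈ y∈ y∉P x∈)

      -- Both ends of the `r`-edge in `P` are joined in `r` to the whole red side, so a clique there
      -- extends by two vertices.
      red-side-clique : ∀ n {P x₀ x y} → P ∈ parts → x₀ ∈ P → x ∈ P → y ∈ P → Edge r x y →
                        NoClique (2 + n) r (_∈ S) → NoClique n r (λ z → z ∈ S × Edge r x₀ z × z ∉ P)
      red-side-clique n P∈ x₀∈ x∈ y∈ xy K = noClique-⊆ n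
        (λ (z∈ , e , z∉) → (z∈ , red-of-part P∈ x₀∈ x∈ z∈ z∉ e) , red-of-part P∈ x₀∈ y∈ z∈ z∉ e)
        (K (part⊆ P∈ x∈) (part⊆ P∈ y∈ , xy))

      red-side-clique₁ : ∀ n {P x₀} → P ∈ parts → x₀ ∈ P →
                         NoClique (1 + n) r (_∈ S) → NoClique n r (λ z → z ∈ S × Edge r x₀ z × z ∉ P)
      red-side-clique₁ n P∈ x₀∈ K = noClique-⊆ n (λ (z∈ , e , _) → z∈ , e) (K (part⊆ P∈ x₀∈))

      -- In caseₘₙ the cut colours r and b have cliques of at most m and n vertices.

      case₂₂ : ∀ {s t} {As : Vector C s} {Bs : Vector C t} i j → Bs i ≡ r → Bs j ≡ b →
               Admissible As Bs (_∈ S) → length S ≤ F s t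
      case₂₂ {t = suc t} {Bs = Bs} i j eqr eqb adm with index-removeAt Bs i eqr (r≢b ∘ ≡-sym) j eqb
      case₂₂ {s} {suc (suc t)} {Bs = Bs} i j eqr eqb adm | j′ , eq′ =
        sum-parts (λ X⊆S two → ramsey₃₃ two (noClique-⊆ 3 X⊆S K₃r) (noClique-⊆ 3 X⊆S K₃b))
          (λ P∈ → part-IH P∈ (drop₂ j′ eq′ (Swapped.part-clique 2 P∈ K₃b)
                               (drop₂ i eqr (part-clique 2 P∈ K₃r) (restrict-adm (part⊆ P∈) adm))))
          (≤-reflexive (5F≡F s t))
        where
        K₃r = subst (λ a → NoClique 3 a (_∈ S)) eqr (Admissible.noK3 adm i)
        K₃b = subst (λ a → NoClique 3 a (_∈ S)) eqb (Admissible.noK3 adm j)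

      -- Parts have no `b`-edge. If some part has an `r`-edge, that part keeps `r` as a `K3` colour,
      -- its red side loses `r` and its blue side loses `b`. Otherwise there are at most eight
      -- parts, free of both colours.
      case₃₂ : ∀ {s t} {As : Vector C s} {Bs : Vector C t} i j → As i ≡ r → Bs j ≡ b →
               Admissible As Bs (_∈ S) → 5 ≤ length S → length S ≤ F s t
      case₃₂ {suc s} {suc t} i j eqr eqb adm 5≤S = by-cases
        (∃ λ P → ∃₂ λ x y → P ∈ parts × x ∈ P × y ∈ P × Edge r x y)
        (λ (P , x , y , P∈ , x∈ , y∈ , xy) → ≤-trans
          (split-at P∈ x∈
            (part-IH P∈ (lower₃ i eqr (part-clique 3 P∈ K₄r)
              (drop₂ j eqb (Swapped.part-clique 2 P∈ K₃b) (restrict-adm (part⊆ P∈) adm))))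
            (IH proj₁ (part⊆ P∈ x∈) (λ (_ , _ , x∉) → x∉ x∈)
              (drop₃ i eqr (red-side-clique 2 P∈ x∈ x∈ y∈ xy K₄r) (restrict-adm proj₁ adm)))
            (IH proj₁ (part⊆ P∈ x∈) (λ (_ , _ , x∉) → x∉ x∈)
              (drop₂ j eqb (noClique-⊆ 2 (λ (z∈ , e , _) → z∈ , e) (K₃b (part⊆ P∈ x∈))) (restrict-adm proj₁ adm))))
          (case₃₂-sum s t))
        (λ ¬∃ → sum-parts (λ X⊆S two → ramsey₃₄ (swap-colours two) (noClique-⊆ 3 X⊆S K₃b) (noClique-⊆ 4 X⊆S K₄r))
          (λ P∈ → part-IH P∈ (drop₃ i eqr (λ x∈ (y∈ , xy) → ¬∃ (_ , _ , _ , P∈ , x∈ , y∈ , xy))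
            (drop₂ j eqb (Swapped.part-clique 2 P∈ K₃b) (restrict-adm (part⊆ P∈) adm))))
          (8F≤F s t))
        where
        K₄r = noK4 (subst (λ a → NoK4e a (_∈ S)) eqr (Admissible.noK4e adm i)) 5≤S
        K₃b = subst (λ a → NoClique 3 a (_∈ S)) eqb (Admissible.noK3 adm j)

      -- A set without red edges is joined in blue along the parts, so it loses
      -- all of its blue edges on one side of the join and the blue triangles on the other.
      red-free-bound : ∀ {s t} {As : Vector C (suc s)} {Bs : Vector C t} {Y : V → Set} {z} j → As j ≡ b →
        Admissible As Bs Y → (∀ {x} → Y x → x ∈ S) → z ∈ S → ¬ Y z →
        NoClique 2 r Y → NoClique 4 b (_∈ S) → Bound Y (F s t + F s (suc t))
      red-free-bound j eq adm Y⊆S z∈ z∉ K₂r K₄b [] uT T⊆ = z≤n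
      red-free-bound {Y = Y} j eq adm Y⊆S z∈ z∉ K₂r K₄b T@(_ ∷ _) uT T⊆ with part-of (Y⊆S (T⊆ (here refl)))
      ... | Q , Q∈ , y∈Q = join-bound j eq adm Y⊆S (noClique-⊆ 4 Y⊆S K₄b) (_∈? Q) (T⊆ (here refl)) y∈Q
        (noClique-⊆ 3 proj₂ (Swapped.part-clique 3 Q∈ K₄b))
        (λ x∈ y∈ x∈Q y∉Q → [ (λ e → ⊥-elim (K₂r y∈ (x∈ , e))) , edge-sym ]′ (outside Q∈ (Y⊆S y∈) y∉Q x∈Q))
        z∈ (z∉ ∘ proj₁) z∈ (z∉ ∘ proj₁) T uT T⊆

    module _ (noCut : ∀ {a} → ¬ Cut (Edge a) S) where

      -- The red side of `P` loses `r` and is bounded by `red-free-bound`; in `P`, `r` becomes a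
      -- `K3` colour. If `P` also has a `b`-edge, the same holds with the colours exchanged. If not,
      -- `P` loses `b`, while on the blue side `b` becomes a `K3` colour.
      case₃₃-edge : ∀ {s t} {As : Vector C s} {Bs : Vector C t} {r b} (κ : Cut (Edge₂ r b) S) (Π : Parts r b S) i j →
        As i ≡ r → As j ≡ b → Admissible As Bs (_∈ S) → NoClique 4 r (_∈ S) → NoClique 4 b (_∈ S) →
        ∀ {P x y} → P ∈ Parts.parts Π → x ∈ P → y ∈ P → Edge r x y → length S ≤ F s t
      case₃₃-edge {suc s} {As = As} κ Π i j eqr eqb adm K₄r K₄b P∈ x∈ y∈ xy
        with index-removeAt As i eqr (Prime.r≢b noCut κ Π ∘ ≡-sym) j eqb | index-removeAt As j eqb (Prime.r≢b noCut κ Π) i eqr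
      case₃₃-edge {suc (suc s)} {t} {r = r} {b} κ Π i j eqr eqb adm K₄r K₄b {P} {x} P∈ x∈ y∈ xy | j′ , eqb′ | i′ , eqr′ =
        by-cases (∃₂ λ u v → u ∈ P × v ∈ P × Edge b u v)
          (λ (u , v , u∈ , v∈ , uv) → ≤-trans
            (split-at P∈ x∈
              (part-IH P∈ (lower₃ j′ eqb′ (Blue.part-clique 3 P∈ K₄b) lowered))
              red-bound
              (BlueCases.red-free-bound i′ eqr′
                (drop₃ j eqb (BlueCases.red-side-clique 2 P∈ x∈ u∈ v∈ uv K₄b) (restrict-adm proj₁ adm))
                proj₁ (part⊆ P∈ x∈) (λ (_ , _ , x∉) → x∉ x∈)
                (BlueCases.red-side-clique 2 P∈ x∈ u∈ v∈ uv K₄b) K₄r))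
            (case₃₃-sum₁ s t))
          (λ ¬∃ → ≤-trans
            (split-at P∈ x∈
              (part-IH P∈ (drop₃ j′ eqb′ (λ u∈ (v∈ , uv) → ¬∃ (_ , _ , u∈ , v∈ , uv)) lowered))
              red-bound
              (IH proj₁ (part⊆ P∈ x∈) (λ (_ , _ , x∉) → x∉ x∈)
                (lower₃ j eqb (BlueCases.red-side-clique₁ 3 P∈ x∈ K₄b) (restrict-adm proj₁ adm))))
            (case₃₃-sum₂ s t))
        where
        open Prime noCut κ Π
        open PrimeCases noCut κ Π
        module Blue = Prime noCut (cut-map ⊎-swap κ) (swap-parts Π)
        module BlueCases = PrimeCases noCut (cut-map ⊎-swap κ) (swap-parts Π)
        lowered = lower₃ i eqr (part-clique 3 P∈ K₄r) (restrict-adm (part⊆ P∈) adm)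
        red-bound : Bound (λ y → y ∈ S × Edge r x y × y ∉ P) (F s t + F s (suc t))
        red-bound = red-free-bound j′ eqb′
          (drop₃ i eqr (red-side-clique 2 P∈ x∈ x∈ y∈ xy K₄r) (restrict-adm proj₁ adm))
          proj₁ (part⊆ P∈ x∈) (λ (_ , _ , x∉) → x∉ x∈)
          (red-side-clique 2 P∈ x∈ x∈ y∈ xy K₄r) K₄b

      case₃₃ : ∀ {s t} {As : Vector C s} {Bs : Vector C t} {r b} (κ : Cut (Edge₂ r b) S) (Π : Parts r b S) i j →
        As i ≡ r → As j ≡ b → Admissible As Bs (_∈ S) → 5 ≤ length S → length S ≤ F s t
      case₃₃ {suc s} {As = As} κ Π i j eqr eqb adm 5≤S with index-removeAt As i eqr (Prime.r≢b noCut κ Π ∘ ≡-sym) j eqb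
      case₃₃ {suc (suc s)} {t} {r = r} {b} κ Π i j eqr eqb adm 5≤S | j′ , eqb′ =
        by-cases (∃ λ P → ∃₂ λ x y → P ∈ parts × x ∈ P × y ∈ P × Edge r x y)
          (λ (_ , _ , _ , P∈ , x∈ , y∈ , xy) → case₃₃-edge κ Π i j eqr eqb adm K₄r K₄b P∈ x∈ y∈ xy)
          λ ¬red → by-cases (∃ λ P → ∃₂ λ x y → P ∈ parts × x ∈ P × y ∈ P × Edge b x y)
            (λ (_ , _ , _ , P∈ , x∈ , y∈ , xy) →
              case₃₃-edge (cut-map ⊎-swap κ) (swap-parts Π) j i eqb eqr adm K₄b K₄r P∈ x∈ y∈ xy)
            λ ¬blue → sum-parts (λ X⊆S two → ramsey₄₄ two (noClique-⊆ 4 X⊆S K₄r) (noClique-⊆ 4 X⊆S K₄b))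
              (λ P∈ → part-IH P∈ (drop₃ j′ eqb′ (λ x∈ (y∈ , xy) → ¬blue (_ , _ , _ , P∈ , x∈ , y∈ , xy))
                (drop₃ i eqr (λ x∈ (y∈ , xy) → ¬red (_ , _ , _ , P∈ , x∈ , y∈ , xy)) (restrict-adm (part⊆ P∈) adm))))
              (≤-reflexive (17F≡F s t))
        where
        open Prime noCut κ Π
        open PrimeCases noCut κ Π
        K₄r = noK4 (subst (λ a → NoK4e a (_∈ S)) eqr (Admissible.noK4e adm i)) 5≤S
        K₄b = Prime.noK4 noCut (cut-map ⊎-swap κ) (swap-parts Π)
          (subst (λ a → NoK4e a (_∈ S)) eqb (Admissible.noK4e adm j)) 5≤S

      -- `noK4` takes a fifth vertex outside the clique; smaller sets are covered by `4≤F`.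
      assume-5≤ : ∀ {s t} {As : Vector C s} {a} i → As i ≡ a → (5 ≤ length S → length S ≤ F s t) → length S ≤ F s t
      assume-5≤ {suc s} {t} i eq f with 5 ≤? length S
      ... | yes 5≤S = f 5≤S
      ... | no ¬5≤S = ≤-trans (s≤s⁻¹ (≰⇒> ¬5≤S)) (4≤F s t)

      prime-bound : ∀ {s t} {As : Vector C s} {Bs : Vector C t} {r b} → Cut (Edge₂ r b) S → Parts r b S →
                    Admissible As Bs (_∈ S) → length S ≤ F s t
      prime-bound {t = t} {As = As} κ Π adm
        with Prime.some-edge noCut κ Π | Prime.some-edge noCut (cut-map ⊎-swap κ) (swap-parts Π)
      ... | _ , _ , x∈ , y∈ , xy | _ , _ , u∈ , v∈ , uv
        with Admissible.covered adm x∈ y∈ xy | Admissible.covered adm u∈ v∈ uv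
      ... | inj₁ (i , eqr) | inj₁ (j , eqb) = assume-5≤ {t = t} {As = As} i eqr (case₃₃ κ Π i j eqr eqb adm)
      ... | inj₁ (i , eqr) | inj₂ (j , eqb) = assume-5≤ {t = t} {As = As} i eqr (PrimeCases.case₃₂ noCut κ Π i j eqr eqb adm)
      ... | inj₂ (i , eqr) | inj₁ (j , eqb) = assume-5≤ {t = t} {As = As} j eqb
        (PrimeCases.case₃₂ noCut (cut-map ⊎-swap κ) (swap-parts Π) j i eqb eqr adm)
      ... | inj₂ (i , eqr) | inj₂ (j , eqb) = PrimeCases.case₂₂ noCut κ Π i j eqr eqb adm

  -- Adding `z` to a list in `Y` gives a list in `S`, so lists in `Y` are shorter and the recursion
  -- on the length applies.
  bound-proper : ∀ {S : List V} {Y : V → Set} {z m n} → Unique S → (∀ {x} → Y x → x ∈ S) → z ∈ S → ¬ Y z →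
                 length S ≤ suc n →
                 (∀ T → Unique T → length T ≤ n → (∀ {x} → x ∈ T → Y x) → length T ≤ m) → Bound Y m
  bound-proper {S} uniq Y⊆S z∈ z∉ len f T uT T⊆ = f T uT
    (s≤s⁻¹ (≤-trans (bound-list S (_ ∷ T)
      (All.tabulate (λ { x∈ refl → z∉ (T⊆ x∈) }) ∷ uT)
      λ { (here refl) → z∈ ; (there x∈) → Y⊆S (T⊆ x∈) }) len)) T⊆

  upper-bound : ∀ n (S : List V) → Unique S → length S ≤ n →
                ∀ {s t} {As : Vector C s} {Bs : Vector C t} → Admissible As Bs (_∈ S) → length S ≤ F s t
  upper-bound n [] _ _ _ = z≤n
  upper-bound n (x ∷ []) _ _ {s} {t} _ = F-pos s t
  -- The goal is stable, so the doubly negated cut and parts may be used. Assuming that it fails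
  -- also rules out every cut in one colour, by `cut-bound`.
  upper-bound (suc n) S@(_ ∷ _ ∷ _) uniq len {s} {t} adm = stable-≤ λ ¬goal →
    gallai-cut uniq λ κ → refine _ S ≤-refl (_ , here refl) λ Π →
      ¬goal (prime-bound (λ κ′ → ¬goal (cut-bound adm κ′)) κ Π adm)
    where
    IH : ∀ {s t} {As : Vector C s} {Bs : Vector C t} {Y : V → Set} {z} →
         (∀ {x} → Y x → x ∈ S) → z ∈ S → ¬ Y z → Admissible As Bs Y → Bound Y (F s t)
    IH Y⊆S z∈ z∉ adm-Y = bound-proper uniq Y⊆S z∈ z∉ len
      λ T uT lenT T⊆ → upper-bound n T uT lenT (restrict-adm T⊆ adm-Y)
    open Step uniq IH

  -- Monochromatic copies and the upper bound

  monoCopy-K4e : ∀ {a x y z w u} →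
    Edge a x y → Edge a x z → Edge a x w → Edge a y z → Edge a y w → Edge a z w →
    Edge a x u → u ≢ y → u ≢ z → u ≢ w → MonoCopy c K4e a
  monoCopy-K4e {a} {x} {y} {z} {w} {u} xy xz xw yz yw zw xu u≢y u≢z u≢w = f , inj , adj
    where
    open Clique₄ xy xz xw yz yw zw
    vs : Vec V 5
    -- In `K4e` the pendant edge joins 3F to 4F, so `x` stands fourth and `u` last.
    vs = w ∷ z ∷ y ∷ x ∷ u ∷ []
    f : Fin 5 → V
    f = lookup vs
    unique : VecUnique.Unique vs
    unique =
      (≢-sym (proj₁ zw) ∷ ≢-sym (proj₁ yw) ∷ ≢-sym (proj₁ xw) ∷ ≢-sym u≢w ∷ []) ∷
      (≢-sym (proj₁ yz) ∷ ≢-sym (proj₁ xz) ∷ ≢-sym u≢z ∷ []) ∷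
      (≢-sym (proj₁ xy) ∷ ≢-sym u≢y ∷ []) ∷
      (proj₁ xu ∷ []) ∷ [] ∷ []
    inj : Injective _≡_ _≡_ f
    inj = lookup-injective unique _ _
    f∈K : ∀ i → toℕ i < 4 → f i ∈ K
    f∈K 0F _ = there (there (there (here refl)))
    f∈K 1F _ = there (there (here refl))
    f∈K 2F _ = there (here refl)
    f∈K 3F _ = here refl
    f∈K 4F 4<4 = contradiction 4<4 (<-irrefl refl)
    adj : ∀ i j → K4eAdj i j → col c (f i) (f j) ≡ a
    adj i j (inK4 .i .j i<4 j<4 i≢j) = proj₂ (K-edge (f∈K i i<4) (f∈K j j<4) (i≢j ∘ inj))
    adj _ _ pend = proj₂ xu
    adj _ _ pend' = proj₂ (edge-sym xu)

  monoCopy-K3 : ∀ {a x y z} → Edge a x y → Edge a x z → Edge a y z → MonoCopy c K3 a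
  monoCopy-K3 {a} {x} {y} {z} xy xz yz = lookup vs , inj , adj
    where
    vs : Vec V 3
    vs = x ∷ y ∷ z ∷ []
    inj : Injective _≡_ _≡_ (lookup vs)
    inj = lookup-injective ((proj₁ xy ∷ proj₁ xz ∷ []) ∷ (proj₁ yz ∷ []) ∷ [] ∷ []) _ _
    adj : ∀ i j → i ≢ j → col c (lookup vs i) (lookup vs j) ≡ a
    adj 0F 0F i≢j = contradiction refl i≢j
    adj 0F 1F _ = proj₂ xy
    adj 0F 2F _ = proj₂ xz
    adj 1F 0F _ = proj₂ (edge-sym xy)
    adj 1F 1F i≢j = contradiction refl i≢j
    adj 1F 2F _ = proj₂ yz
    adj 2F 0F _ = proj₂ (edge-sym xz)
    adj 2F 1F _ = proj₂ (edge-sym yz)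
    adj 2F 2F i≢j = contradiction refl i≢j

  K4e-or-free : ∀ a → MonoCopy c K4e a ⊎ (∀ {X : V → Set} → NoK4e a X)
  K4e-or-free a with any? (λ x → any? λ y → any? λ z → any? λ w → any? λ u →
    Edge? a x y ×-dec Edge? a x z ×-dec Edge? a x w ×-dec Edge? a y z ×-dec Edge? a y w ×-dec Edge? a z w ×-dec
    Edge? a x u ×-dec ¬? (u ≟ y) ×-dec ¬? (u ≟ z) ×-dec ¬? (u ≟ w))
  ... | yes (_ , _ , _ , _ , _ , xy , xz , xw , yz , yw , zw , xu , u≢y , u≢z , u≢w) =
    inj₁ (monoCopy-K4e xy xz xw yz yw zw xu u≢y u≢z u≢w)
  ... | no ¬∃ = inj₂ λ _ _ _ _ _ xy xz xw yz yw zw xu u≢y u≢z u≢w →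
    ¬∃ (_ , _ , _ , _ , _ , xy , xz , xw , yz , yw , zw , xu , u≢y , u≢z , u≢w)

  K3-or-free : ∀ a → MonoCopy c K3 a ⊎ (∀ {X : V → Set} → NoClique 3 a X)
  K3-or-free a with any? (λ x → any? λ y → any? λ z → Edge? a x y ×-dec Edge? a x z ×-dec Edge? a y z)
  ... | yes (_ , _ , _ , xy , xz , yz) = inj₁ (monoCopy-K3 xy xz yz)
  ... | no ¬∃ = inj₂ λ _ (_ , xy) ((_ , xz) , yz) → ¬∃ (_ , _ , _ , xy , xz , yz)

  Free : ℕ → C → Set₁
  Free s a = (toℕ a < s → ∀ {X : V → Set} → NoK4e a X) × (¬ toℕ a < s → ∀ {X : V → Set} → NoClique 3 a X)

  copy-or-free : ∀ s a → MonoCopy c (Hfam k s a) a ⊎ Free s a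
  copy-or-free s a with toℕ a <? s
  ... | yes a<s = ⊎-map id (λ free → (λ _ {X} → free {X}) , contradiction a<s) (K4e-or-free a)
  ... | no a≮s = ⊎-map id (λ free → (λ a<s → contradiction a<s a≮s) , (λ _ {X} → free {X})) (K3-or-free a)

search : ∀ {n} {P : Fin n → Set} {Q : Fin n → Set₁} → (∀ i → P i ⊎ Q i) → ∃ P ⊎ (∀ i → Q i)
search {zero} f = inj₂ λ ()
search {suc n} f with f 0F | search (f ∘ Fin.suc)
... | inj₁ p | _ = inj₁ (0F , p)
... | inj₂ q | inj₁ (i , p) = inj₁ (Fin.suc i , p)
... | inj₂ q | inj₂ qs = inj₂ λ { 0F → q ; (Fin.suc i) → qs i }

arrows : ∀ s t → Arrows (F s t + 1) (s + t) s
arrows s t c gal with search (copy-or-free s)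
  where open Gallai-structure c gal
... | inj₁ copy = copy
... | inj₂ free = contradiction
  (upper-bound _ (allFin (F s t + 1)) (allFin⁺ (F s t + 1)) ≤-refl adm)
  (<⇒≱ (≤-reflexive (trans (+-comm 1 (F s t)) (≡-sym (length-tabulate id)))))
  where
  open Gallai-structure c gal
  As : Vector C s
  As i = i ↑ˡ t
  Bs : Vector C t
  Bs j = s ↑ʳ j
  adm : Admissible As Bs (_∈ allFin (F s t + 1))
  adm = record
    { covered = λ {a} _ _ _ → cover a
    ; noK4e = λ i → proj₁ (free (As i)) (subst (_< s) (≡-sym (toℕ-↑ˡ i t)) (toℕ<n i))
    ; noK3 = λ j → proj₂ (free (Bs j)) (≤⇒≯ (subst (s ≤_) (≡-sym (toℕ-↑ʳ s j)) (m≤m+n s (toℕ j)))) }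
    where
    cover : ∀ a → (∃ λ i → As i ≡ a) ⊎ (∃ λ j → Bs j ≡ a)
    cover a with splitAt s a in eq
    ... | inj₁ i = inj₁ (i , splitAt⁻¹-↑ˡ eq)
    ... | inj₂ j = inj₂ (j , splitAt⁻¹-↑ʳ eq)

-- Substitution of colourings

-- inj₁ i encodes the colour i and inj₂ j the colour s + j.
Colour : Set
Colour = ℕ ⊎ ℕ

-- The type `Colour` has no bounds, so adding colours leaves the old ones unchanged; the range in
-- use is recorded here.
Valid : ℕ → ℕ → Colour → Set
Valid s t (inj₁ i) = i < s
Valid s t (inj₂ j) = j < t

record Good (s t : ℕ) (X : Set) : Set where
  field
    colour : X → X → Colour

  E : Colour → X → X → Set
  E a x y = x ≢ y × colour x y ≡ a

  field
    colour-sym : ∀ {x y} → x ≢ y → colour x y ≡ colour y x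
    valid      : ∀ {x y} → x ≢ y → Valid s t (colour x y)
    gallai     : ∀ {x y z} → x ≢ y → y ≢ z → x ≢ z →
                 colour x y ≡ colour y z ⊎ colour y z ≡ colour x z ⊎ colour x y ≡ colour x z
    noK4e      : ∀ {i x y z w u} → E (inj₁ i) x y → E (inj₁ i) x z → E (inj₁ i) x w →
                 E (inj₁ i) y z → E (inj₁ i) y w → E (inj₁ i) z w → E (inj₁ i) x u →
                 u ≢ y → u ≢ z → u ≢ w → ⊥
    noK3       : ∀ {j x y z} → E (inj₂ j) x y → E (inj₂ j) x z → E (inj₂ j) y z → ⊥

-- Serves to replace a product by `Fin` of its size, and to pass to fewer vertices.
pullback : ∀ {s t X Y} (f : Y → X) → Injective _≡_ _≡_ f → Good s t X → Good s t Y
pullback {s} {t} {X} {Y} f inj G = record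
  { colour = λ x y → colour (f x) (f y)
  ; colour-sym = λ x≢y → colour-sym (x≢y ∘ inj)
  ; valid = λ x≢y → valid (x≢y ∘ inj)
  ; gallai = λ x≢y y≢z x≢z → gallai (x≢y ∘ inj) (y≢z ∘ inj) (x≢z ∘ inj)
  ; noK4e = λ xy xz xw yz yw zw xu u≢y u≢z u≢w → noK4e (e xy) (e xz) (e xw) (e yz) (e yw) (e zw) (e xu)
      (u≢y ∘ inj) (u≢z ∘ inj) (u≢w ∘ inj)
  ; noK3 = λ xy xz yz → noK3 (e xy) (e xz) (e yz) }
  where
  open Good G
  e : ∀ {a x y} → x ≢ y × colour (f x) (f y) ≡ a → E a (f x) (f y)
  e (x≢y , eq) = x≢y ∘ inj , eq

module Layer {m : ℕ} (β : Fin m → Fin m → Bool) where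

  BaseEdge : Bool → Fin m → Fin m → Set
  BaseEdge e a b = a ≢ b × β a b ≡ e

  BaseEdge? : ∀ e a b → Dec (BaseEdge e a b)
  BaseEdge? e a b = ¬? (a ≟ b) ×-dec (β a b ≟ᵇ e)

  -- Here and in `K₄Free`, hypotheses stand between the quantifiers so that the exhaustive search
  -- extends only tuples that are already cliques.
  TriangleFree : Bool → Set
  TriangleFree e = ∀ a b → BaseEdge e a b → ∀ d → ¬ (BaseEdge e a d × BaseEdge e b d)

  triangleFree? : ∀ e → Dec (TriangleFree e)
  triangleFree? e = all? λ a → all? λ b → BaseEdge? e a b →-dec
    all? λ d → ¬? (BaseEdge? e a d ×-dec BaseEdge? e b d)

  K₄Free : Bool → Set
  K₄Free e = ∀ a b → BaseEdge e a b → ∀ d → BaseEdge e a d × BaseEdge e b d →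
    ∀ f → ¬ (BaseEdge e a f × BaseEdge e b f × BaseEdge e d f)

  k₄Free? : ∀ e → Dec (K₄Free e)
  k₄Free? e = all? λ a → all? λ b → BaseEdge? e a b →-dec
    all? λ d → (BaseEdge? e a d ×-dec BaseEdge? e b d) →-dec
    all? λ f → ¬? (BaseEdge? e a f ×-dec BaseEdge? e b f ×-dec BaseEdge? e d f)

  -- Each base vertex becomes a copy of `X`, and base edges receive colours foreign to `G`. A clique
  -- in an old colour stays inside one copy, together with a pendant edge; a clique in a new colour
  -- projects to a clique of the base, excluded by `free₄` and `free₃`.
  module Substitute {s t s′ t′ : ℕ} {X : Set} (G : Good s t X) (κ : Bool → Colour)
    (κ-injective : Injective _≡_ _≡_ κ)
    (β-sym : ∀ a b → β a b ≡ β b a)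
    (fresh : ∀ e → ¬ Valid s t (κ e))
    (κ-valid : ∀ {a b} → a ≢ b → Valid s′ t′ (κ (β a b)))
    (valid-mono : ∀ a → Valid s t a → Valid s′ t′ a)
    (free₄ : ∀ {i} e → κ e ≡ inj₁ i → K₄Free e)
    (free₃ : ∀ {j} e → κ e ≡ inj₂ j → TriangleFree e) where

    open Good G

    colour′ : Fin m × X → Fin m × X → Colour
    colour′ (a , x) (b , y) with a ≟ b
    ... | yes _ = colour x y
    ... | no  _ = κ (β a b)

    data View (c : Colour) : Fin m × X → Fin m × X → Set where
      inner : ∀ {a x y} → E c x y → View c (a , x) (a , y)
      outer : ∀ {a b x y} e → BaseEdge e a b → κ e ≡ c → View c (a , x) (b , y)

    view : ∀ {c p q} → p ≢ q → colour′ p q ≡ c → View c p q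
    view {p = a , x} {b , y} p≢q eq with a ≟ b
    ... | yes refl = inner ((λ { refl → p≢q refl }) , eq)
    ... | no a≢b = outer (β a b) (a≢b , refl) eq

    inner-eq : ∀ {c a x b y} → View c (a , x) (b , y) → Valid s t c → a ≡ b × E c x y
    inner-eq (inner e) _ = refl , e
    inner-eq (outer e _ refl) v = contradiction v (fresh e)

    outer-eq : ∀ {c a x b y} e → κ e ≡ c → View c (a , x) (b , y) → BaseEdge e a b
    outer-eq e refl (inner (x≢y , eq)) = contradiction (subst (Valid s t) eq (valid x≢y)) (fresh e)
    outer-eq e eq (outer e′ be eq′) with κ-injective (trans eq (≡-sym eq′))
    ... | refl = be

    inner-valid : ∀ {a x y} → E a x y → Valid s t a
    inner-valid (x≢y , eq) = subst (Valid s t) eq (valid x≢y)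

    substitute : Good s′ t′ (Fin m × X)
    substitute = record
      { colour = colour′
      ; colour-sym = csym
      ; valid = cvalid
      ; gallai = cgallai
      ; noK4e = cK4e
      ; noK3 = cK3
      }
      where
      csym : ∀ {p q} → p ≢ q → colour′ p q ≡ colour′ q p
      csym {a , x} {b , y} p≢q with a ≟ b | b ≟ a
      ... | yes refl | yes _ = colour-sym λ { refl → p≢q refl }
      ... | no _ | no _ = cong κ (β-sym a b)
      ... | yes refl | no b≢b = contradiction refl b≢b
      ... | no a≢a | yes refl = contradiction refl a≢a
      cvalid : ∀ {p q} → p ≢ q → Valid s′ t′ (colour′ p q)
      cvalid {a , x} {b , y} p≢q with a ≟ b
      ... | yes refl = valid-mono _ (valid λ { refl → p≢q refl })
      ... | no a≢b = κ-valid a≢b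
      two : ∀ e e′ e″ → κ e ≡ κ e′ ⊎ κ e′ ≡ κ e″ ⊎ κ e ≡ κ e″
      two true true _ = inj₁ refl
      two false false _ = inj₁ refl
      two true false true = inj₂ (inj₂ refl)
      two true false false = inj₂ (inj₁ refl)
      two false true true = inj₂ (inj₁ refl)
      two false true false = inj₂ (inj₂ refl)
      cgallai : ∀ {p q r} → p ≢ q → q ≢ r → p ≢ r →
                colour′ p q ≡ colour′ q r ⊎ colour′ q r ≡ colour′ p r ⊎ colour′ p q ≡ colour′ p r
      cgallai {a , x} {b , y} {d , z} p≢q q≢r p≢r with a ≟ b | b ≟ d | a ≟ d
      ... | yes refl | yes refl | yes _ = gallai (λ { refl → p≢q refl }) (λ { refl → q≢r refl }) (λ { refl → p≢r refl })
      ... | yes refl | yes refl | no a≢a = contradiction refl a≢a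
      ... | yes refl | no a≢a | yes refl = contradiction refl a≢a
      ... | yes refl | no _ | no _ = inj₂ (inj₁ refl)
      ... | no _ | yes refl | no _ = inj₂ (inj₂ refl)
      ... | no a≢a | yes refl | yes refl = contradiction refl a≢a
      ... | no _ | no _ | yes refl = inj₁ (cong κ (β-sym a b))
      ... | no _ | no _ | no _ = two (β a b) (β b d) (β a d)
      cK3 : ∀ {j p q r} → p ≢ q × colour′ p q ≡ inj₂ j → p ≢ r × colour′ p r ≡ inj₂ j → q ≢ r × colour′ q r ≡ inj₂ j → ⊥
      cK3 {r = d , z} (p≢q , pq) (p≢r , pr) (q≢r , qr) with view p≢q pq | view p≢r pr | view q≢r qr
      ... | outer e be eq | V₂ | V₃ = free₃ e eq _ _ be _ (outer-eq e eq V₂ , outer-eq e eq V₃)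
      ... | inner xy | V₂ | V₃ with inner-eq V₂ (inner-valid xy) | inner-eq V₃ (inner-valid xy)
      ...   | _ , xz | _ , yz = noK3 xy xz yz
      cK4e : ∀ {i p q r w u} → p ≢ q × colour′ p q ≡ inj₁ i → p ≢ r × colour′ p r ≡ inj₁ i → p ≢ w × colour′ p w ≡ inj₁ i →
             q ≢ r × colour′ q r ≡ inj₁ i → q ≢ w × colour′ q w ≡ inj₁ i → r ≢ w × colour′ r w ≡ inj₁ i →
             p ≢ u × colour′ p u ≡ inj₁ i → u ≢ q → u ≢ r → u ≢ w → ⊥
      cK4e {r = _ , _} {_ , _} {_ , _} (p≢q , pq) (p≢r , pr) (p≢w , pw) (q≢r , qr) (q≢w , qw) (r≢w , rw) (p≢u , pu) u≢q u≢r u≢w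
        with view p≢q pq | view p≢r pr | view p≢w pw | view q≢r qr | view q≢w qw | view r≢w rw | view p≢u pu
      ... | outer e be eq | Vpr | Vpw | Vqr | Vqw | Vrw | _ = free₄ e eq _ _ be _
        (outer-eq e eq Vpr , outer-eq e eq Vqr) _ (outer-eq e eq Vpw , outer-eq e eq Vqw , outer-eq e eq Vrw)
      ... | inner xy | Vpr | Vpw | Vqr | Vqw | Vrw | Vpu
        with inner-eq Vpr (inner-valid xy) | inner-eq Vpw (inner-valid xy) | inner-eq Vpu (inner-valid xy)
      ...   | refl , xz | refl , xw | refl , xu = noK4e xy xz xw
        (proj₂ (inner-eq Vqr (inner-valid xy))) (proj₂ (inner-eq Vqw (inner-valid xy))) (proj₂ (inner-eq Vrw (inner-valid xy)))
        xu (λ { refl → u≢q refl }) (λ { refl → u≢r refl }) (λ { refl → u≢w refl })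

-- The nonzero quadratic residues modulo 5 and 17. As -1 is a residue for both primes, the absolute
-- difference of two vertices determines their colour.
residue : ℕ → ℕ → Bool
residue 5 1 = true
residue 5 4 = true
residue 17 1 = true
residue 17 2 = true
residue 17 4 = true
residue 17 8 = true
residue 17 9 = true
residue 17 13 = true
residue 17 15 = true
residue 17 16 = true
residue _ _ = false

-- Paley colourings: the pentagon for m = 5, and for m = 17 the extremal colouring for R(4,4).
paley : ∀ m → Fin m → Fin m → Bool
paley m a b = residue m ∣ toℕ a - toℕ b ∣

paley-sym : ∀ m a b → paley m a b ≡ paley m b a
paley-sym m a b = cong (residue m) (∣-∣-comm (toℕ a) (toℕ b))

paley₅ : ∀ e → Layer.TriangleFree (paley 5) e
paley₅ true  = from-yes (Layer.triangleFree? (paley 5) true)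
paley₅ false = from-yes (Layer.triangleFree? (paley 5) false)

paley₁₇ : ∀ e → Layer.K₄Free (paley 17) e
paley₁₇ true  = from-yes (Layer.k₄Free? (paley 17) true)
paley₁₇ false = from-yes (Layer.k₄Free? (paley 17) false)

constant : Fin 2 → Fin 2 → Bool
constant _ _ = true

constant₂ : ∀ e → Layer.TriangleFree constant e
constant₂ true  = from-yes (Layer.triangleFree? constant true)
constant₂ false = from-yes (Layer.triangleFree? constant false)

pair : ∀ {A : Set} → (ℕ → A) → ℕ → Bool → A
pair inj n true  = inj n
pair inj n false = inj (suc n)

pair-injective : ∀ {A : Set} {inj : ℕ → A} n → Injective _≡_ _≡_ inj → Injective _≡_ _≡_ (pair inj n)
pair-injective n inj {true}  {true}  eq = refl
pair-injective n inj {false} {false} eq = refl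
pair-injective n inj {true}  {false} eq = contradiction (≡-sym (inj eq)) 1+n≢n
pair-injective n inj {false} {true}  eq = contradiction (inj eq) 1+n≢n

pair-fresh : ∀ n e → ¬ pair id n e < n
pair-fresh n true  = <-irrefl refl
pair-fresh n false = <-asym (n<1+n n)

pair-valid : ∀ n e → pair id n e < 2 + n
pair-valid n true  = m≤n+m (suc n) 1
pair-valid n false = ≤-refl

add-paley₁₇ : ∀ {s X} → Good s 0 X → Good (2 + s) 0 (Fin 17 × X)
add-paley₁₇ {s} G = Layer.Substitute.substitute (paley 17) G (pair inj₁ s)
  (pair-injective s inj₁-injective) (paley-sym 17)
  (λ { true → pair-fresh s true ; false → pair-fresh s false })
  (λ {a} {b} _ → valid (paley 17 a b))
  (λ { (inj₁ i) i<s → m≤n⇒m≤o+n 2 i<s })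
  (λ e _ → paley₁₇ e)
  (λ { true () ; false () })
  where
  valid : ∀ e → Valid (2 + s) 0 (pair inj₁ s e)
  valid true  = pair-valid s true
  valid false = pair-valid s false

add-paley₅ : ∀ {s t X} → Good s t X → Good s (2 + t) (Fin 5 × X)
add-paley₅ {s} {t} G = Layer.Substitute.substitute (paley 5) G (pair inj₂ t)
  (pair-injective t inj₂-injective) (paley-sym 5)
  (λ { true → pair-fresh t true ; false → pair-fresh t false })
  (λ {a} {b} _ → valid (paley 5 a b))
  (λ { (inj₁ i) i<s → i<s ; (inj₂ j) j<t → m≤n⇒m≤o+n 2 j<t })
  (λ { true () ; false () })
  (λ e _ → paley₅ e)
  where
  valid : ∀ e → Valid s (2 + t) (pair inj₂ t e)
  valid true  = pair-valid t true
  valid false = pair-valid t false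

double : ∀ {s X} → Good s 0 X → Good s 1 (Fin 2 × X)
double {s} G = Layer.Substitute.substitute constant G (pair inj₂ 0)
  (pair-injective 0 inj₂-injective) (λ _ _ → refl)
  (λ { true () ; false () })
  -- `constant` takes only the value `true`, so only the colour `inj₂ 0` has to be valid.
  (λ _ → s≤s z≤n)
  (λ { (inj₁ i) i<s → i<s })
  (λ { true () ; false () })
  (λ e _ → constant₂ e)

-- Extremal colourings and the lower bound

remQuot-injective : ∀ {m} n → Injective _≡_ _≡_ (remQuot {m} n)
remQuot-injective {m} n {i} {j} eq = begin
  i                                                       ≡⟨ combine-remQuot {m} n i ⟨
  combine (proj₁ (remQuot {m} n i)) (proj₂ (remQuot {m} n i)) ≡⟨ cong (λ (a , x) → combine a x) eq ⟩
  combine (proj₁ (remQuot {m} n j)) (proj₂ (remQuot {m} n j)) ≡⟨ combine-remQuot {m} n j ⟩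
  j ∎
  where open ≡-Reasoning

good-g : ∀ s → Good s 0 (Fin (g s))
good-g 0 = record
  { colour = λ _ _ → inj₁ 0
  ; colour-sym = λ _ → refl
  ; valid = λ { {0F} {0F} x≢x → contradiction refl x≢x }
  ; gallai = λ _ _ _ → inj₁ refl
  ; noK4e = λ { {x = 0F} {0F} (x≢x , _) → contradiction refl x≢x }
  ; noK3 = λ { (_ , ()) } }
good-g 1 = record
  { colour = λ _ _ → inj₁ 0
  ; colour-sym = λ _ → refl
  ; valid = λ _ → s≤s z≤n
  ; gallai = λ _ _ _ → inj₁ refl
  ; noK4e = λ {_} {x} {y} {z} {w} {u} (x≢y , _) (x≢z , _) (x≢w , _) (y≢z , _) (y≢w , _) (z≢w , _) (x≢u , _) u≢y u≢z u≢w →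
      contradiction
        (injective⇒≤ {f = lookup (x ∷ y ∷ z ∷ w ∷ u ∷ [])} (lookup-injective
          ((x≢y ∷ x≢z ∷ x≢w ∷ x≢u ∷ []) ∷ (y≢z ∷ y≢w ∷ ≢-sym u≢y ∷ []) ∷ (z≢w ∷ ≢-sym u≢z ∷ []) ∷ (≢-sym u≢w ∷ []) ∷ [] ∷ []) _ _))
        (<-irrefl refl)
  ; noK3 = λ { (_ , ()) } }
good-g (suc (suc s)) = pullback (remQuot {17} (g s)) (remQuot-injective (g s)) (add-paley₁₇ (good-g s))

good : ∀ s t → Good s t (Fin (F s t))
good s 0 = subst (λ n → Good s 0 (Fin n)) (≡-sym (*-identityʳ (g s))) (good-g s)
good s 1 = subst (λ n → Good s 1 (Fin n)) (*-comm 2 (g s))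
  (pullback (remQuot {2} (g s)) (remQuot-injective (g s)) (double (good-g s)))
good s (suc (suc t)) = subst (λ n → Good s (2 + t) (Fin n)) (5F≡F s t)
  (pullback (remQuot {5} (F s t)) (remQuot-injective (F s t)) (add-paley₅ (good s t)))

module Avoiding {s t M : ℕ} (G : Good s t (Fin M)) (default : Fin (s + t)) where
  open Good G

  rank : Colour → ℕ
  rank = [ id , s +_ ]′

  -- The default colour is only ever used on the diagonal.
  encode : Colour → Fin (s + t)
  encode a with rank a <? s + t
  ... | yes p = fromℕ< p
  ... | no  _ = default

  rank-valid : ∀ a → Valid s t a → rank a < s + t
  rank-valid (inj₁ i) i<s = m≤n⇒m≤n+o t i<s
  rank-valid (inj₂ j) j<t = +-monoʳ-< s j<t

  toℕ-encode : ∀ a → Valid s t a → toℕ (encode a) ≡ rank a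
  toℕ-encode a v with rank a <? s + t
  ... | yes p = toℕ-fromℕ< p
  ... | no ¬p = contradiction (rank-valid a v) ¬p

  colouring : Colouring M (s + t)
  colouring = record
    { col = λ x y → encode (colour x y)
    ; sym = λ x y x≢y → cong encode (colour-sym x≢y) }

  colouring-gallai : Gallai colouring
  colouring-gallai x y z (x≢y , y≢z , x≢z , p , q , r) with gallai x≢y y≢z x≢z
  ... | inj₁ eq = p (cong encode eq)
  ... | inj₂ (inj₁ eq) = q (cong encode eq)
  ... | inj₂ (inj₂ eq) = r (cong encode eq)

  decode₁ : ∀ {i x y} → toℕ i < s → x ≢ y × col colouring x y ≡ i → E (inj₁ (toℕ i)) x y
  decode₁ {x = x} {y} i<s (x≢y , refl) = x≢y , go (colour x y) (valid x≢y) i<s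
    where
    go : ∀ a → Valid s t a → toℕ (encode a) < s → a ≡ inj₁ (toℕ (encode a))
    go a@(inj₁ _) v _ = cong inj₁ (≡-sym (toℕ-encode a v))
    go a@(inj₂ j) v i<s = contradiction (subst (_< s) (toℕ-encode a v) i<s) (≤⇒≯ (m≤m+n s j))

  decode₂ : ∀ {i x y} → ¬ toℕ i < s → x ≢ y × col colouring x y ≡ i → E (inj₂ (toℕ i ∸ s)) x y
  decode₂ {x = x} {y} i≮s (x≢y , refl) = x≢y , go (colour x y) (valid x≢y) i≮s
    where
    go : ∀ a → Valid s t a → ¬ toℕ (encode a) < s → a ≡ inj₂ (toℕ (encode a) ∸ s)
    go a@(inj₁ _) v i≮s = contradiction (subst (_< s) (≡-sym (toℕ-encode a v)) v) i≮s
    go a@(inj₂ j) v _ = cong inj₂ (≡-sym (trans (cong (_∸ s) (toℕ-encode a v)) (m+n∸m≡n s j)))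

  avoids : ∀ i → ¬ MonoCopy colouring (Hfam (s + t) s i) i
  avoids i with toℕ i <? s
  ... | yes i<s = λ (f , inj , adj) →
    let distinct : ∀ a b → a ≢ b → f a ≢ f b
        distinct a b a≢b eq = a≢b (inj eq)
        e : ∀ a b → toℕ a < 4 → toℕ b < 4 → a ≢ b → E (inj₁ (toℕ i)) (f a) (f b)
        e a b a<4 b<4 a≢b = decode₁ i<s (distinct a b a≢b , adj a b (inK4 a b a<4 b<4 a≢b))
    -- The vertex 3F carries the pendant edge and therefore comes first.
    in noK4e (e 3F 0F !< !< λ ()) (e 3F 1F !< !< λ ()) (e 3F 2F !< !< λ ())
             (e 0F 1F !< !< λ ()) (e 0F 2F !< !< λ ()) (e 1F 2F !< !< λ ())
             (decode₁ i<s (distinct 3F 4F (λ ()) , adj 3F 4F pend))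
             (distinct 4F 0F λ ()) (distinct 4F 1F λ ()) (distinct 4F 2F λ ())
    where
    !< : ∀ {m n} → {True (m <? n)} → m < n
    !< {_} {_} {p} = toWitness p
  ... | no i≮s = λ (f , inj , adj) →
    let e : ∀ a b → a ≢ b → E (inj₂ (toℕ i ∸ s)) (f a) (f b)
        e a b a≢b = decode₂ i≮s ((λ eq → a≢b (inj eq)) , adj a b a≢b)
    in noK3 (e 0F 1F λ ()) (e 0F 2F λ ()) (e 1F 2F λ ())

-- The colouring on `F s t` vertices is restricted to `M` of them; `default` ensures that there is a
-- colour for the diagonal.
not-arrows : ∀ s t → Fin (s + t) → ∀ M → M < F s t + 1 → ¬ Arrows M (s + t) s
not-arrows s t default M M<F arr = let i , copy = arr colouring colouring-gallai in avoids i copy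
  where
  M≤F : M ≤ F s t
  M≤F = s≤s⁻¹ (subst (M <_) (+-comm (F s t) 1) M<F)
  open Avoiding (pullback (λ i → inject≤ i M≤F) (inject≤-injective M≤F M≤F _ _) (good s t)) default

-- Agreement with the closed formula

data Parity : ℕ → Set where
  -- The form `a * 2` fits the lemmas on division, and `suc a * 2` reduces to two successors,
  -- matching the recursion of `g` and `h`.
  even : ∀ a → Parity (a * 2)
  odd  : ∀ a → Parity (1 + a * 2)

parity : ∀ n → Parity n
parity 0 = even 0
parity (suc n) with parity n
... | even a = odd a
... | odd a = even (suc a)

g-even : ∀ a → g (a * 2) ≡ 17 ^ a
g-even zero = refl
g-even (suc a) = cong (17 *_) (g-even a)

g-odd : ∀ a → g (1 + a * 2) ≡ 4 * 17 ^ a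
g-odd zero = refl
g-odd (suc a) = trans (cong (17 *_) (g-odd a)) (swap-factors 17 4 (17 ^ a))

h-even : ∀ a → h (a * 2) ≡ 5 ^ a
h-even zero = refl
h-even (suc a) = cong (5 *_) (h-even a)

h-odd : ∀ a → h (1 + a * 2) ≡ 2 * 5 ^ a
h-odd zero = refl
h-odd (suc a) = trans (cong (5 *_) (h-odd a)) (swap-factors 5 2 (5 ^ a))

even%2 : ∀ a → a * 2 % 2 ≡ 0
even%2 a = m*n%n≡0 a 2

odd%2 : ∀ a → (1 + a * 2) % 2 ≡ 1
odd%2 a = [m+kn]%n≡m%n 1 a 2

half : ∀ a → a * 2 / 2 ≡ a
half a = m*n/n≡m a 2

grValue-parity : ∀ k {s t} → k ∸ s ≡ t → Parity s → Parity t → grValue k s ≡ F s t + 1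
grValue-parity k eq (even a) (even b)
  -- Once the remainders are known, `go` unfolds and exposes `k ∸ s` again; hence the second `eq`.
  rewrite eq | even%2 a | even%2 b | eq | half a | half b | g-even a | h-even b = refl
grValue-parity k eq (even a) (odd b)
  rewrite eq | even%2 a | odd%2 b | eq | half a | half b | g-even a | h-odd b =
  cong (_+ 1) (rearrange (17 ^ a) (5 ^ b))
  where
  rearrange : ∀ x y → 2 * x * y ≡ x * (2 * y)
  rearrange = solve-∀
grValue-parity k eq (odd a) (even b)
  rewrite eq | odd%2 a | even%2 b | eq | half a | half b | g-odd a | h-even b = refl
grValue-parity k eq (odd a) (odd b)
  rewrite eq | odd%2 a | odd%2 b | eq | half a | half b | g-odd a | h-odd b =
  cong (_+ 1) (rearrange (17 ^ a) (5 ^ b))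
  where
  rearrange : ∀ x y → 8 * x * y ≡ 4 * x * (2 * y)
  rearrange = solve-∀

grValue≡ : ∀ k s → grValue k s ≡ F s (k ∸ s) + 1
grValue≡ k s = grValue-parity k refl (parity s) (parity (k ∸ s))

theorem5p1 : (k s : ℕ) → 1 ≤ k → s ≤ k → IsGR k s (grValue k s)
theorem5p1 k s 1≤k s≤k = subst₂ (λ m n → IsGR m s n) k≡ (≡-sym (grValue≡ k s))
  (arrows s (k ∸ s) , not-arrows s (k ∸ s) (fromℕ< (subst (1 ≤_) (≡-sym k≡) 1≤k)))
  where
  k≡ : s + (k ∸ s) ≡ k
  k≡ = m+[n∸m]≡n s≤k
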